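{- Let $n\ge 1$ and let $\rho_n=(n,n-1,\ldots,2,1)$. For all strict partitions $\lambda,\mu,\nu\subseteq\rho_n$ one has $$D_{\lambda,\mu}^{\nu}=D_{\mu,\lambda}^{\nu}.$$ That is, the product $[\lambda]\star[\mu]=\sum_{\nu\subseteq\rho_n}D_{\lambda,\mu}^{\nu}[\nu]$, on the free module $R_n$ with basis the formal symbols $[\lambda]$ ($\lambda\subseteq\rho_n$ a strict partition), is commutative.
   Context: **Strict partitions and shifted shapes.** A strict partition is $\lambda=(\lambda_1>\lambda_2>\cdots>\lambda_\ell>0)$; put $\ell(\lambda)=\ell$ and $|\lambda|=\sum_i\lambda_i$. Identify $\lambda$ with its shifted shape: row $i$ (from the top) has boxes in matrix positions $(i,j)$ with $i\le j<\lambda_i+i$. If $\mu\subseteq\lambda$ (containment of shifted shapes), $\lambda/\mu$ is the set of boxes of $\lambda$ not in $\mu$; $\lambda=\lambda/\emptyset$ is a straight shape. Boxes $(i,i)$ are diagonal boxes. A diagonal edge of $\lambda/\mu$ is the southern edge of a diagonal box of $\lambda$ (including diagonal boxes of $\lambda$ lying in $\mu$). **Shifted edge labeled tableaux.** $\mathrm{eqShSYT}(\lambda/\mu,N)$ is the set of fillings of the boxes of $\lambda/\mu$ and of the diagonal edges of $\lambda/\mu$ by labels in $[N]=\{1,\ldots,N\}$ such that: (S1) every box of $\lambda/\mu$ contains exactly one label; (S2) each diagonal edge contains a (possibly empty) subset of $[N]$; (S3) each of $1,\ldots,N$ appears exactly once; (S4) labels strictly increase left to right along rows and top to bottom along columns;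 in particular each label on a diagonal edge is strictly larger than all box labels in the same column. **Slides.** An inner corner $c$ of $\lambda/\mu$ is a maximally southeast box of $\mu$ (no box of $\mu$ immediately to its right or immediately below it). For $T\in\mathrm{eqShSYT}(\lambda/\mu,N)$, the slide $\mathrm{shEjdt}_c(T)$ is obtained as follows. Place $\bullet$ in $c$. At each step let $a$ be the label in the box immediately right of $\bullet$ (if any), $b$ the label in the box immediately below $\bullet$ (if any), and, if $\bullet$ is in a diagonal box, $S$ the set of labels on its southern edge (a diagonal box has no box below it). Apply: (J1) if $b<a$, or $b$ exists and $a$ does not: swap $\bullet$ and $b$ ($\bullet$ moves down); (J2) if $a<b$, or $a$ exists and $b$ does not (and, if $\bullet$ is in a diagonal box, $S=\emptyset$): swap $\bullet$ and $a$ ($\bullet$ moves right); (J3') if $\bullet$ is in a diagonal box, $S\neq\emptyset$, $a$ exists and $a<\min S$: swap $\bullet$ and $a$, leaving $S$ in place; (J4') if $\bullet$ is in a diagonal box, $S\ne\emptyset$ and $s:=\min S<a$ (or $a$ does not exist): put $s$ in the box in place of $\bullet$ and replace $S$ by $S\setminus\{s\}$; the slide then ends. Repeat from the new position of $\bullet$ until (J4') has been applied or there are no labels immediately south or east of $\bullet$; then erase $\bullet$ (in the latter case the box it occupies is removed from the shape). **Rectification.** $\mathrm{shEqRect}(T)$ is the straight-shape tableau obtained from $T\in\mathrm{eqShSYT}(\lambda/\mu,N)$ by applying $|\mu|$ successive slides, each time into the southmost inner corner of the current shape (row rectification order). **Structure constants.** $S_\mu$ is the superstandard tableau of shifted shape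 $\mu$: its boxes are filled by $1,2,3,\ldots,|\mu|$ in English reading order (rows top to bottom, each left to right), with no edge labels. Define $$d_{\lambda,\mu}^\nu=\#\{T\in\mathrm{eqShSYT}(\nu/\lambda,|\mu|):\ \mathrm{shEqRect}(T)=S_\mu\}$$ (which is $0$ if $\lambda\not\subseteq\nu$), $\Delta(\nu;\lambda,\mu)=|\lambda|+|\mu|-|\nu|$, $L(\nu;\lambda,\mu)=\ell(\lambda)+\ell(\mu)-\ell(\nu)$, and, for an indeterminate $z$, $$D_{\lambda,\mu}^\nu=2^{L(\nu;\lambda,\mu)-\Delta(\nu;\lambda,\mu)}\,z^{\Delta(\nu;\lambda,\mu)}\,d_{\lambda,\mu}^\nu .$$ (If $\Delta(\nu;\lambda,\mu)<0$ then $d_{\lambda,\mu}^{\nu}=0$ and $D_{\lambda,\mu}^\nu=0$, so $D_{\lambda,\mu}^\nu\in\mathbb{Q}[z]$.) $R_n$ is regarded as a free $\mathbb{Q}[z]$-module and $\star$ is extended bilinearly. -}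

module Defs where

open import Data.Bool using (if_then_else_)
open import Data.Fin as Fin using (Fin; zero; suc; toℕ; fromℕ<)
import Data.Fin.Properties as Fin
open import Data.Fin.Subset using (Subset; inside; outside; _-_) renaming (_∈_ to _∈ˢ_; ⊥ to ∅)
open import Data.Fin.Subset.Properties using () renaming (_∈?_ to _∈ˢ?_)
open import Data.Integer as ℤ using (ℤ; +_; -[1+_])
open import Data.List as List using (List; []; _∷_; length; filter; map; foldr; last; cartesianProductWith)
import Data.List.Membership.DecPropositional as ListMembership
import Data.List.Properties as List
open import Data.List.Relation.Binary.Subset.Propositional using () renaming (_⊆_ to _⊆ˡ_)
import Data.List.Relation.Binary.Subset.DecPropositional as ListSubset
open import Data.List.Relation.Unary.All as All using (All; []; _∷_)
open import Data.List.Relation.Unary.Linked using (Linked; []; [-]; _∷_)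
open import Data.Maybe as Maybe using (Maybe; just; nothing)
import Data.Maybe.Properties as Maybe
open import Data.Nat as ℕ using (ℕ; zero; suc; _+_; _*_; _^_; _<_; _>_; _≤_; z≤n; s≤s)
open import Data.Nat.ListAction using (sum)
import Data.Nat.Properties as ℕ
open import Data.Product using (_×_; _,_; proj₁; proj₂)
open import Data.Product.Properties using (≡-dec)
open import Data.Rational as ℚ using (ℚ; 0ℚ)
open import Data.Vec as Vec using (Vec; []; _∷_; lookup; tabulate; allFin)
import Data.Vec.Membership.DecPropositional as VecMembership
import Data.Vec.Properties as Vec
import Data.Vec.Relation.Unary.Any as VecAny
import Data.Bool.Properties as Bool
open import Function using (_∘_)
open import Relation.Binary.Definitions using (DecidableEquality)
open import Relation.Binary.PropositionalEquality using (_≡_)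
open import Relation.Nullary using (Dec; yes; no; does)
open import Relation.Nullary.Decidable using (¬?; _×-dec_; _→-dec_)

------------------------------------------------------------------------
-- Strict partitions and shifted shapes

record StrictPartition : Set where
  constructor strictPartition
  field
    parts    : List ℕ
    strict   : Linked _>_ parts
    positive : All (0 <_) parts

open StrictPartition public

ℓ : StrictPartition → ℕ
ℓ = length ∘ parts

∣_∣ : StrictPartition → ℕ
∣ κ ∣ = sum (parts κ)

-- Matrix positions (row , column), both counted from 0, so that the
-- diagonal is still given by row = column and row i of the shifted
-- shape of λ still consists of the (i , j) with i ≤ j < λᵢ + i.
Box : Set
Box = ℕ × ℕ

row col : Box → ℕ
row = proj₁
col = proj₂

right below : Box → Box
right (i , j) = i , suc j
below (i , j) = suc i , j

_≟ᴮ_ : DecidableEquality Box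
_≟ᴮ_ = ≡-dec ℕ._≟_ ℕ._≟_

open ListMembership _≟ᴮ_ using (_∈_; _∉_; _∈?_)
open VecMembership _≟ᴮ_ using () renaming (_∈?_ to _∈ᵛ?_)
open ListSubset _≟ᴮ_ using () renaming (_⊆?_ to _⊆ˡ?_)

boxesFrom : ℕ → (ps : List ℕ) → Vec Box (sum ps)
boxesFrom i []       = []
boxesFrom i (p ∷ ps) = tabulate {n = p} (λ k → i , i + toℕ k) Vec.++ boxesFrom (suc i) ps

-- In English reading order.
boxes : (κ : StrictPartition) → Vec Box ∣ κ ∣
boxes κ = boxesFrom 0 (parts κ)

-- Sets of boxes are lists without repetition, in English reading order.
Shape : Set
Shape = List Box

shape : StrictPartition → Shape
shape κ = Vec.toList (boxes κ)

infix 4 _⊆_ _⊆?_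

_⊆_ : StrictPartition → StrictPartition → Set
κ ⊆ ν = shape κ ⊆ˡ shape ν

_⊆?_ : (κ ν : StrictPartition) → Dec (κ ⊆ ν)
κ ⊆? ν = shape κ ⊆ˡ? shape ν

remove : Box → Shape → Shape
remove c = filter (λ p → ¬? (p ≟ᴮ c))

skew : StrictPartition → StrictPartition → Shape
skew ν κ = filter (λ p → ¬? (p ∈? shape κ)) (shape ν)

IsInnerCorner : Shape → Box → Set
IsInnerCorner κ c = c ∈ κ × right c ∉ κ × below c ∉ κ

isInnerCorner? : ∀ κ c → Dec (IsInnerCorner κ c)
isInnerCorner? κ c = (c ∈? κ) ×-dec ¬? (right c ∈? κ) ×-dec ¬? (below c ∈? κ)

-- Distinct inner corners lie in distinct rows, so the southmost one is
-- the last one in reading order.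
southmostInnerCorner : Shape → Maybe Box
southmostInnerCorner κ = last (filter (isInnerCorner? κ) κ)

------------------------------------------------------------------------
-- Shifted edge labeled tableaux.  The label k of [N] = {1,…,N} is the
-- element k - 1 of Fin N.

-- A filling of ν/κ satisfying (S1) and (S2): the labels of the boxes of
-- ν/κ, in reading order, and the sets on the diagonal edges of ν, from
-- top to bottom.
record Filling (ν κ : StrictPartition) (N : ℕ) : Set where
  constructor filling
  field
    labels : Vec (Fin N) (length (skew ν κ))
    edges  : Vec (Subset N) (ℓ ν)

module _ {ν κ : StrictPartition} {N : ℕ} (T : Filling ν κ N) where
  open Filling T

  private
    at : Fin (length (skew ν κ)) → Box
    at = List.lookup (skew ν κ)

  occurrences : Fin N → ℕ
  occurrences x = Vec.count (Fin._≟ x) labels + Vec.count (x ∈ˢ?_) edges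

  EachLabelOnce : Set
  EachLabelOnce = ∀ x → occurrences x ≡ 1

  RowsIncrease : Set
  RowsIncrease = ∀ k l → row (at k) ≡ row (at l) → col (at k) < col (at l) →
    lookup labels k Fin.< lookup labels l

  ColumnsIncrease : Set
  ColumnsIncrease = ∀ k l → col (at k) ≡ col (at l) → row (at k) < row (at l) →
    lookup labels k Fin.< lookup labels l

  -- The i-th diagonal edge lies in column i, below all boxes of that column.
  EdgesIncrease : Set
  EdgesIncrease = ∀ i k x → col (at k) ≡ toℕ i → x ∈ˢ lookup edges i →
    lookup labels k Fin.< x

  -- (S3) and (S4).
  IsTableau : Set
  IsTableau = EachLabelOnce × RowsIncrease × ColumnsIncrease × EdgesIncrease

  isTableau? : Dec IsTableau
  isTableau? =
    Fin.all? (λ x → occurrences x ℕ.≟ 1)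
    ×-dec Fin.all? (λ k → Fin.all? λ l →
      (row (at k) ℕ.≟ row (at l)) →-dec (col (at k) ℕ.<? col (at l)) →-dec
      (lookup labels k Fin.<? lookup labels l))
    ×-dec Fin.all? (λ k → Fin.all? λ l →
      (col (at k) ℕ.≟ col (at l)) →-dec (row (at k) ℕ.<? row (at l)) →-dec
      (lookup labels k Fin.<? lookup labels l))
    ×-dec Fin.all? (λ i → Fin.all? λ k → Fin.all? λ x →
      (col (at k) ℕ.≟ toℕ i) →-dec (x ∈ˢ? lookup edges i) →-dec
      (lookup labels k Fin.<? x))

vectors : {A : Set} → List A → (k : ℕ) → List (Vec A k)
vectors xs zero    = [] ∷ []
vectors xs (suc k) = cartesianProductWith _∷_ xs (vectors xs k)

subsets : (N : ℕ) → List (Subset N)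
subsets = vectors (inside ∷ outside ∷ [])

fillings : ∀ ν κ N → List (Filling ν κ N)
fillings ν κ N = cartesianProductWith filling
  (vectors (List.allFin N) (length (skew ν κ))) (vectors (subsets N) (ℓ ν))

-- Each element of eqShSYT(ν/κ,N) is listed exactly once.
eqShSYT : ∀ ν κ N → List (Filling ν κ N)
eqShSYT ν κ N = filter isTableau? (fillings ν κ N)

------------------------------------------------------------------------
-- Slides and rectification

-- A tableau of shape outer/inner whose shape may change during slides.
-- The label of a box is nothing if the box is outside outer/inner or
-- occupied by •; edge i is the set on the southern edge of (i , i).
record Tableau (N : ℕ) : Set where
  constructor tableau
  field
    outer inner : Shape
    box         : Box → Maybe (Fin N)
    edge        : ℕ → Subset N

open Tableau public

infix 4 _≐_ _≐?_

-- Equality as fillings of a straight shape: since every row of such a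
-- shape contains a diagonal box, its diagonal edges are indexed by the
-- rows of its boxes.
_≐_ : ∀ {N} → Tableau N → Tableau N → Set
T ≐ S = outer T ≡ outer S × inner T ≡ inner S ×
  All (λ p → box T p ≡ box S p × edge T (row p) ≡ edge S (row p)) (outer S)

_≐?_ : ∀ {N} (T S : Tableau N) → Dec (T ≐ S)
T ≐? S = List.≡-dec _≟ᴮ_ (outer T) (outer S) ×-dec List.≡-dec _≟ᴮ_ (inner T) (inner S) ×-dec
  All.all? (λ p → Maybe.≡-dec Fin._≟_ (box T p) (box S p)
                  ×-dec Vec.≡-dec Bool._≟_ (edge T (row p)) (edge S (row p))) (outer S)

labelIn : ∀ {N k} → Vec Box k → Vec (Fin N) k → Box → Maybe (Fin N)
labelIn ps xs p with p ∈ᵛ? ps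
... | yes p∈ps = just (lookup xs (VecAny.index p∈ps))
... | no  _    = nothing

edgeIn : ∀ {N k} → Vec (Subset N) k → ℕ → Subset N
edgeIn {k = k} es i with i ℕ.<? k
... | yes i<k = lookup es (fromℕ< i<k)
... | no  _   = ∅

toTableau : ∀ {ν κ N} → Filling ν κ N → Tableau N
toTableau {ν} {κ} T = tableau (shape ν) (shape κ)
  (labelIn (Vec.fromList (skew ν κ)) (Filling.labels T)) (edgeIn (Filling.edges T))

superstandard : (μ : StrictPartition) → Tableau ∣ μ ∣
superstandard μ = tableau (shape μ) [] (labelIn (boxes μ) (allFin ∣ μ ∣)) (λ _ → ∅)

minimum : ∀ {N} → Subset N → Maybe (Fin N)
minimum []            = nothing
minimum (inside  ∷ S) = just zero
minimum (outside ∷ S) = Maybe.map suc (minimum S)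

-- settle s is the move (J4') with s = min S.
data Move (N : ℕ) : Set where
  goRight goDown stop : Move N
  settle              : Fin N → Move N

offDiagonal : ∀ {N} (a b : Maybe (Fin N)) → Move N
offDiagonal nothing  nothing  = stop
offDiagonal nothing  (just b) = goDown
offDiagonal (just a) nothing  = goRight
offDiagonal (just a) (just b) = if does (b Fin.<? a) then goDown else goRight

onDiagonal : ∀ {N} (a minS : Maybe (Fin N)) → Move N
onDiagonal nothing  nothing  = stop
onDiagonal (just a) nothing  = goRight
onDiagonal nothing  (just s) = settle s
onDiagonal (just a) (just s) = if does (a Fin.<? s) then goRight else settle s

move : ∀ {N} → Tableau N → Box → Move N
move T p = if does (row p ℕ.≟ col p)
  then onDiagonal (box T (right p)) (minimum (edge T (row p)))
  else offDiagonal (box T (right p)) (box T (below p))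

setBox : ∀ {N} → Box → Maybe (Fin N) → Tableau N → Tableau N
setBox p x T = record T { box = λ q → if does (q ≟ᴮ p) then x else box T q }

setEdge : ∀ {N} → ℕ → Subset N → Tableau N → Tableau N
setEdge i S T = record T { edge = λ k → if does (k ℕ.≟ i) then S else edge T k }

-- Swap • in p with the label in q.
swap : ∀ {N} → Box → Box → Tableau N → Tableau N
swap p q T = setBox p (box T q) (setBox q nothing T)

-- slideFrom m p runs the slide with • in p.  The number m bounds the
-- remaining positions of •, which are distinct boxes of the outer shape;
-- starting from the size of the outer shape the first clause is not reached.
slideFrom : ∀ {N} → ℕ → Box → Tableau N → Tableau N
slideFrom zero    p T = T
slideFrom (suc m) p T with move T p
... | goRight  = slideFrom m (right p) (swap p (right p) T)
... | goDown   = slideFrom m (below p) (swap p (below p) T)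
... | settle s = setEdge (row p) (edge T (row p) - s) (setBox p (just s) T)
... | stop     = record T { outer = remove p (outer T) }

shEjdt : ∀ {N} → Box → Tableau N → Tableau N
shEjdt c T = slideFrom (length (outer T)) c (record T { inner = remove c (inner T) })

slideSouthmost : ∀ {N} → Tableau N → Tableau N
slideSouthmost T with southmostInnerCorner (inner T)
... | just c  = shEjdt c T
... | nothing = T

slides : ∀ {N} → ℕ → Tableau N → Tableau N
slides zero    T = T
slides (suc m) T = slides m (slideSouthmost T)

shEqRect : ∀ {ν κ N} → Filling ν κ N → Tableau N
shEqRect {κ = κ} T = slides ∣ κ ∣ (toTableau T)

------------------------------------------------------------------------
-- ℚ[z]: coefficient lists, constant term first

ℚ[z] : Set
ℚ[z] = List ℚ

coeff : ℚ[z] → ℕ → ℚ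
coeff []      k       = 0ℚ
coeff (a ∷ p) zero    = a
coeff (a ∷ p) (suc k) = coeff p k

infix 4 _≈_
infixl 6 _⊕_
infixl 7 _⊗_

_≈_ : ℚ[z] → ℚ[z] → Set
p ≈ q = ∀ k → coeff p k ≡ coeff q k

_⊕_ : ℚ[z] → ℚ[z] → ℚ[z]
[]      ⊕ q       = q
(a ∷ p) ⊕ []      = a ∷ p
(a ∷ p) ⊕ (b ∷ q) = (a ℚ.+ b) ∷ (p ⊕ q)

_⊗_ : ℚ[z] → ℚ[z] → ℚ[z]
[]      ⊗ q = []
(a ∷ p) ⊗ q = map (a ℚ.*_) q ⊕ (0ℚ ∷ (p ⊗ q))

monomial : ℚ → ℕ → ℚ[z]
monomial a zero    = a ∷ []
monomial a (suc k) = 0ℚ ∷ monomial a k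

∑ : {A : Set} → List A → (A → ℚ[z]) → ℚ[z]
∑ xs f = foldr (λ x p → f x ⊕ p) [] xs

2^_ : ℤ → ℚ
2^ (+ k)    = + (2 ^ k) ℚ./ 1
2^ -[1+ k ] = ℚ._/_ (+ 1) (2 ^ suc k) {{ℕ.m^n≢0 2 (suc k)}}

------------------------------------------------------------------------
-- Structure constants; d κ μ ν, Δ κ μ ν, L κ μ ν and D κ μ ν have ν as
-- the upper index.

d : (κ μ ν : StrictPartition) → ℕ
d κ μ ν = if does (κ ⊆? ν)
  then length (filter (λ T → shEqRect T ≐? superstandard μ) (eqShSYT ν κ ∣ μ ∣))
  else 0

Δ L : (κ μ ν : StrictPartition) → ℤ
Δ κ μ ν = + ∣ κ ∣ ℤ.+ + ∣ μ ∣ ℤ.- + ∣ ν ∣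
L κ μ ν = + ℓ κ ℤ.+ + ℓ μ ℤ.- + ℓ ν

D : (κ μ ν : StrictPartition) → ℚ[z]
D κ μ ν with Δ κ μ ν
... | + k      = monomial ((2^ (L κ μ ν ℤ.- + k)) ℚ.* (+ d κ μ ν ℚ./ 1)) k
... | -[1+ _ ] = []

------------------------------------------------------------------------
-- The strict partitions contained in ρₙ, and Rₙ

-- The parts selected by S, whose entries stand for n , … , 2 , 1.
select : ∀ {n} → Subset n → List ℕ
select         []            = []
select {suc n} (inside  ∷ S) = suc n ∷ select S
select         (outside ∷ S) = select S

select-≤ : ∀ {n} (S : Subset n) → All (_≤ n) (select S)
select-≤ []            = []
select-≤ (inside  ∷ S) = ℕ.≤-refl ∷ All.map ℕ.m≤n⇒m≤1+n (select-≤ S)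
select-≤ (outside ∷ S) = All.map ℕ.m≤n⇒m≤1+n (select-≤ S)

consLinked : ∀ {n ps} → All (_≤ n) ps → Linked _>_ ps → Linked _>_ (suc n ∷ ps)
consLinked []        []           = [-]
consLinked (p≤n ∷ _) [-]          = s≤s p≤n ∷ [-]
consLinked (p≤n ∷ _) (p>q ∷ qs↓)  = s≤s p≤n ∷ p>q ∷ qs↓

select-strict : ∀ {n} (S : Subset n) → Linked _>_ (select S)
select-strict []            = []
select-strict (inside  ∷ S) = consLinked (select-≤ S) (select-strict S)
select-strict (outside ∷ S) = select-strict S

select-positive : ∀ {n} (S : Subset n) → All (0 <_) (select S)
select-positive []            = []
select-positive (inside  ∷ S) = s≤s z≤n ∷ select-positive S
select-positive (outside ∷ S) = select-positive S

fromSubset : ∀ {n} → Subset n → StrictPartition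
fromSubset S = strictPartition (select S) (select-strict S) (select-positive S)

-- The parts of ρ n are n , … , 2 , 1.
ρ : ℕ → StrictPartition
ρ n = fromSubset (Vec.replicate n inside)

-- Irrelevance makes elements with the same partition equal.
record Basis (n : ℕ) : Set where
  constructor ⟨_⟩
  field
    partition  : StrictPartition
    .{contained} : partition ⊆ ρ n

open Basis public using (partition)

-- A strict partition contained in ρₙ is determined by its set of parts,
-- which is a subset of {1,…,n}; so each is listed exactly once.
basis : ∀ n → List (Basis n)
basis n = List.mapMaybe inBasis (map fromSubset (subsets n))
  where
  inBasis : StrictPartition → Maybe (Basis n)
  inBasis κ with κ ⊆? ρ n
  ... | yes κ⊆ρ = just (⟨ κ ⟩ {κ⊆ρ})
  ... | no  _   = nothing

-- The free ℚ[z]-module on Basis n: x ν is the coefficient of [ν].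
R : ℕ → Set
R n = Basis n → ℚ[z]

infix 4 _≈ᴿ_
infixl 7 _⋆_

_≈ᴿ_ : ∀ {n} → R n → R n → Set
x ≈ᴿ y = ∀ ν → x ν ≈ y ν

_[⋆]_ : ∀ {n} → Basis n → Basis n → R n
(κ [⋆] μ) ν = D (partition κ) (partition μ) (partition ν)

-- The bilinear extension of [κ] ⋆ [μ] = ∑ D κ μ ν [ν].
_⋆_ : ∀ {n} → R n → R n → R n
_⋆_ {n} x y ν = ∑ (basis n) λ κ → ∑ (basis n) λ μ → (x κ ⊗ y μ) ⊗ (κ [⋆] μ) ν

{-# OPTIONS --safe #-}
module Submission where

-- The coefficients D κ μ ν and D μ κ ν have the same power of 2 and of z,
-- so commutativity says that d κ μ ν and d μ κ ν count equally many
-- tableaux.  The bijection is tableau infusion, in a version with labels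
-- on diagonal edges.
--
-- A filling of ν/κ that contains each of N labels once is a word: its x-th
-- letter is the place, a box or a diagonal edge, of the label x.  The
-- filling is a tableau exactly when the word is valid over κ: each letter
-- comes after the places it needs (a box after its left and upper
-- neighbours, an edge after its diagonal box), and no box is used twice
-- (reads-valid, fillingOf-tableau).  In other words, a tableau is a chain
-- of shifted shapes from κ to ν, where a label on an edge repeats the
-- shape.
--
-- A slide that starts at u treats the letters t of this word in
-- increasing order.  If t is adjacent to the place of the bullet, the two
-- trade places; otherwise nothing happens (slide-correct).  The move
-- (J4′) is of this kind as well: the label s on the edge of a diagonal
-- box trades places with the bullet, which remains on the edge as a label
-- of the complementary word.  Rectification slides into the boxes of κ
-- from the last one to the first one in reading order, so that it is the
-- infusion of the word of S_κ with the word of the tableau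
-- (rectify-correct).  It consists of local moves on pairs (u , t),
-- arranged in a grid.  In terms of words, a local move leaves u t as it is
-- if the two letters are adjacent, and otherwise replaces it by t u; so it
-- preserves validity and is an involution, and the same is true of
-- infusion (infusion-valid, infusion-sym).
--
-- Hence the tableaux F of shape ν/κ that rectify to S_μ correspond to the
-- tableaux F′ of shape ν/μ that rectify to S_κ: F′ is read off the word
-- that is left when the infusion of S_κ and F has produced S_μ
-- (transpose, transposed-injective).

open import Defs
open import Data.Nat using (ℕ; _≥_)
open import Data.Product using (_×_)
open import Algebra.Definitions using (Commutative)

open import Algebra.Bundles using (CommutativeMonoid)
open import Data.Bool using (if_then_else_)
open import Data.Empty using (⊥; ⊥-elim)
open import Data.Fin as Fin using (Fin; zero; suc; toℕ)
import Data.Fin.Properties as Fin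
open import Data.Fin.Subset using (Subset; inside; outside; _-_; _─_)
  renaming (_∈_ to _∈ˢ_; _∉_ to _∉ˢ_)
open import Data.Fin.Subset.Properties
  using (⊆-antisym; ∉⊥; Empty-unique; _∈?_; x∈p∧x≢y⇒x∈p-y; p─q⊆p; x∈⁅x⁆)
open import Data.Integer as ℤ using (+_; -[1+_])
import Data.Integer.Properties as ℤ
open import Data.List as List using (List; []; _∷_; filter; last; length; map)
import Data.List.Membership.DecPropositional as ListMembership
open import Data.List.Membership.Propositional using (_∈_; _∉_; lose)
open import Data.List.Membership.Propositional.Properties using
  (∈-filter⁺; ∈-filter⁻; ∈-++⁺ˡ; ∈-++⁺ʳ; ∈-++⁻; ∈-lookup; ∈-∃++; ∈-cartesianProductWith⁺; ∈-allFin)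
import Data.List.Properties as List
open import Data.List.Relation.Unary.All as All using (All; []; _∷_)
open import Data.List.Relation.Unary.AllPairs as AllPairs using (AllPairs; []; _∷_)
import Data.List.Relation.Unary.AllPairs.Properties as AllPairs
open import Data.List.Relation.Unary.Any as ListAny using (here; there)
import Data.List.Relation.Unary.Any.Properties as ListAny
open import Data.List.Relation.Unary.Linked using (Linked; _∷_)
open import Data.List.Relation.Unary.Unique.Propositional using (Unique)
import Data.List.Relation.Unary.Unique.Propositional.Properties as Unique
open import Data.Maybe as Maybe using (just; nothing)
import Data.Maybe.Properties as Maybe
open import Data.Nat as ℕ using (zero; suc; _+_; _≤_; _<_; _>_; z≤n; s≤s)
import Data.Nat.Properties as ℕ
open import Data.Product using (_,_; proj₁; proj₂; ∃-syntax)
open import Data.Rational as ℚ using (ℚ; 0ℚ)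
import Data.Rational.Properties as ℚ
open import Data.Sum as Sum using (_⊎_; inj₁; inj₂; [_,_]′)
open import Data.Unit using (⊤; tt)
open import Data.Vec as Vec using (Vec; []; _∷_; _++_; lookup; _[_]≔_; here; there)
import Data.Vec.Membership.DecPropositional as VecMembership
import Data.Vec.Membership.Propositional as Vec
import Data.Vec.Membership.Propositional.Properties as VecMem
import Data.Vec.Properties as Vec
open import Data.Vec.Relation.Unary.Any as VecAny using (here; there)
import Data.Vec.Relation.Unary.Any.Properties as VecAnyP
open import Function using (_∘_; id)
open import Relation.Binary.PropositionalEquality
open import Relation.Nullary using (¬_; Dec; yes; no; contradiction; does)
open import Relation.Nullary.Decidable using (_×-dec_; _⊎-dec_; ¬?; map′; dec-true; dec-false)

open import Algebra.Properties.CommutativeSemigroup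
  (CommutativeMonoid.commutativeSemigroup ℚ.+-0-commutativeMonoid)
  using (interchange; x∙yz≈y∙xz)
open ListMembership _≟ᴮ_ using () renaming (_∈?_ to _∈ᴮ?_)
open VecMembership _≟ᴮ_ using () renaming (_∈?_ to _∈ᵛ?_)

------------------------------------------------------------------------
-- Places and their precedence

-- Where a label can stand: in a box, or on the diagonal edge below the
-- box (i , i).
data Place : Set where
  inBox  : Box → Place
  onEdge : ℕ → Place

-- x ⋖ y means that x has to be occupied when y receives its label: x is
-- the left or upper neighbour of the box y, or the diagonal box of the
-- edge y.  Only boxes weakly above the diagonal are related.
infix 4 _⋖_ _⋖?_

data _⋖_ : Place → Place → Set where
  left  : ∀ {i j} → i ≤ j → inBox (i , j) ⋖ inBox (i , suc j)
  above : ∀ {i j} → suc i ≤ j → inBox (i , j) ⋖ inBox (suc i , j)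
  atop  : ∀ {i} → inBox (i , i) ⋖ onEdge i

_⋖?_ : ∀ x y → Dec (x ⋖ y)
inBox (i , j) ⋖? inBox (k , l) =
  map′ [ (λ { (refl , refl , i≤j) → left i≤j }) , (λ { (refl , refl , i<j) → above i<j }) ]′
       (λ { (left i≤j) → inj₁ (refl , refl , i≤j) ; (above i<j) → inj₂ (refl , refl , i<j) })
       (((i ℕ.≟ k) ×-dec (suc j ℕ.≟ l) ×-dec (i ℕ.≤? j))
        ⊎-dec ((suc i ℕ.≟ k) ×-dec (j ℕ.≟ l) ×-dec (suc i ℕ.≤? j)))
inBox (i , j) ⋖? onEdge k =
  map′ (λ { (refl , refl) → atop }) (λ { atop → refl , refl }) ((i ℕ.≟ k) ×-dec (j ℕ.≟ k))
onEdge _ ⋖? _ = no λ ()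

IsBox : Place → Set
IsBox (inBox _)  = ⊤
IsBox (onEdge _) = ⊥

⋖⇒IsBox : ∀ {x y} → x ⋖ y → IsBox x
⋖⇒IsBox (left _)  = tt
⋖⇒IsBox (above _) = tt
⋖⇒IsBox atop      = tt

-- All boxes of shifted shapes are weakly above the diagonal.
UpperTriangular : Place → Set
UpperTriangular (inBox (i , j)) = i ≤ j
UpperTriangular (onEdge _)      = ⊤

Adjacent : Place → Place → Set
Adjacent x y = x ⋖ y ⊎ y ⋖ x

adjacent? : ∀ x y → Dec (Adjacent x y)
adjacent? x y = (x ⋖? y) ⊎-dec (y ⋖? x)

------------------------------------------------------------------------
-- Valid words of places

-- Sets of occupied places.
Places : Set₁
Places = Place → Set

infixl 5 _∙_

_∙_ : Places → Place → Places
(A ∙ x) z = z ≡ x ⊎ A z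

-- The place x can receive a label once those in A are occupied.  An edge
-- can be used repeatedly.
record Fits (A : Places) (x : Place) : Set where
  field
    preceded        : ∀ {z} → z ⋖ x → A z
    fresh           : IsBox x → ¬ A x
    upperTriangular : UpperTriangular x

open Fits

-- The letters of the word can receive labels one after the other: this
-- is a standard filling read as a chain of growing shapes, in which a
-- label on an edge repeats the shape.
data Valid (A : Places) : ∀ {n} → Vec Place n → Set where
  []  : Valid A []
  _∷_ : ∀ {n x} {w : Vec Place n} → Fits A x → Valid (A ∙ x) w → Valid A (x ∷ w)

private
  variable
    A B : Places
    m n N : ℕ

fits-resp : (∀ z → A z → B z) → (∀ z → B z → A z) → ∀ {x} → Fits A x → Fits B x
fits-resp to from f = record
  { preceded = λ z⋖x → to _ (preceded f z⋖x)
  ; fresh = λ b Bx → fresh f b (from _ Bx)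
  ; upperTriangular = upperTriangular f }

valid-resp : ∀ {w : Vec Place n} → (∀ z → A z → B z) → (∀ z → B z → A z) → Valid A w → Valid B w
valid-resp to from []      = []
valid-resp to from (f ∷ v) = fits-resp to from f ∷
  valid-resp (λ z → Sum.map₂ (to z)) (λ z → Sum.map₂ (from z)) v

valid-prefix : ∀ {u : Vec Place m} {w : Vec Place n} → Valid A (u ++ w) → Valid A u
valid-prefix {u = []}    _       = []
valid-prefix {u = _ ∷ _} (f ∷ v) = f ∷ valid-prefix v

valid-++[] : ∀ {w : Vec Place n} → Valid A w → Valid A (w ++ [])
valid-++[] []      = []
valid-++[] (f ∷ v) = f ∷ valid-++[] v

-- Consecutive letters can be exchanged unless they are adjacent places.
valid-commute : ∀ {x y} {w : Vec Place n} → ¬ Adjacent x y →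
  Valid A (x ∷ y ∷ w) → Valid A (y ∷ x ∷ w)
valid-commute {A = A} {x = x} {y} ¬adj (fx ∷ fy ∷ v) =
  record { preceded = λ z⋖y → [ (λ { refl → ⊥-elim (¬adj (inj₁ z⋖y)) }) , id ]′ (preceded fy z⋖y)
         ; fresh = λ b Ay → fresh fy b (inj₂ Ay)
         ; upperTriangular = upperTriangular fy }
  ∷ record { preceded = λ z⋖x → inj₂ (preceded fx z⋖x)
           ; fresh = λ b → [ (λ { refl → fresh fy b (inj₁ refl) }) , fresh fx b ]′
           ; upperTriangular = upperTriangular fx }
  ∷ valid-resp exchange exchange v
  where
  exchange : ∀ {x y} z → (A ∙ x ∙ y) z → (A ∙ y ∙ x) z
  exchange z (inj₁ e)        = inj₂ (inj₁ e)
  exchange z (inj₂ (inj₁ e)) = inj₁ e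
  exchange z (inj₂ (inj₂ a)) = inj₂ (inj₂ a)

-- Closure under predecessors.
Closed : Places → Set
Closed A = ∀ {x y} → x ⋖ y → A y → A x

closed-∙ : ∀ {x} → Closed A → Fits A x → Closed (A ∙ x)
closed-∙ cl f z⋖x (inj₁ refl) = inj₂ (preceded f z⋖x)
closed-∙ cl f z⋖y (inj₂ Ay)   = inj₂ (cl z⋖y Ay)

------------------------------------------------------------------------
-- Infusion

-- Pass u w w′ u′: the slide of • from u past the labels at w, taken in
-- increasing order, moves them to w′ and • to u′.  A label adjacent to •
-- trades places with it; for an edge and its diagonal box, that is (J4′),
-- with • left on the edge.
data Pass : ∀ {n} → Place → Vec Place n → Vec Place n → Place → Set where
  []   : ∀ {u} → Pass u [] [] u
  trade : ∀ {n u t u′} {w w′ : Vec Place n} → Adjacent u t → Pass t w w′ u′ →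
         Pass u (t ∷ w) (u ∷ w′) u′
  skip : ∀ {n u t u′} {w w′ : Vec Place n} → ¬ Adjacent u t → Pass u w w′ u′ →
         Pass u (t ∷ w) (t ∷ w′) u′

-- Infusion us ts ts′ us′: the slides into the places us, the last one
-- first, move the labels at ts to ts′, and end in the places us′.
data Infusion : ∀ {m n} → Vec Place m → Vec Place n → Vec Place n → Vec Place m → Set where
  []  : ∀ {n} {ts : Vec Place n} → Infusion [] ts ts []
  _∷_ : ∀ {m n u u′} {us us′ : Vec Place m} {ts ts₁ ts₂ : Vec Place n} →
        Pass u ts₁ ts₂ u′ → Infusion us ts ts₁ us′ → Infusion (u ∷ us) ts ts₂ (u′ ∷ us′)

pass-total : ∀ u (w : Vec Place n) → ∃[ w′ ] ∃[ u′ ] Pass u w w′ u′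
pass-total u []      = [] , u , []
pass-total u (t ∷ w) with adjacent? u t
... | yes adj = let w′ , u′ , p = pass-total t w in u ∷ w′ , u′ , trade adj p
... | no ¬adj = let w′ , u′ , p = pass-total u w in t ∷ w′ , u′ , skip ¬adj p

infusion-total : ∀ (us : Vec Place m) (ts : Vec Place n) → ∃[ ts′ ] ∃[ us′ ] Infusion us ts ts′ us′
infusion-total []       ts = ts , [] , []
infusion-total (u ∷ us) ts =
  let ts₁ , us′ , inf = infusion-total us ts
      ts₂ , u′ , p    = pass-total u ts₁
  in ts₂ , u′ ∷ us′ , p ∷ inf

pass-functional : ∀ {u u₁ u₂} {w w₁ w₂ : Vec Place n} →
  Pass u w w₁ u₁ → Pass u w w₂ u₂ → w₁ ≡ w₂ × u₁ ≡ u₂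
pass-functional []         []         = refl , refl
pass-functional (trade _ p) (trade _ q) with refl , refl ← pass-functional p q = refl , refl
pass-functional (trade a _) (skip b _) = contradiction a b
pass-functional (skip a _) (trade b _) = contradiction b a
pass-functional (skip _ p) (skip _ q) with refl , refl ← pass-functional p q = refl , refl

infusion-functional : ∀ {us us₁ us₂ : Vec Place m} {ts ts₁ ts₂ : Vec Place n} →
  Infusion us ts ts₁ us₁ → Infusion us ts ts₂ us₂ → ts₁ ≡ ts₂ × us₁ ≡ us₂
infusion-functional []      []      = refl , refl
infusion-functional (p ∷ i) (q ∷ j)
  with refl , refl ← infusion-functional i j
  with refl , refl ← pass-functional p q = refl , refl

-- Infusion is a grid of local moves between one • and one label.  Each of
-- them is symmetric in the two, so that the grid can be read by columns
-- instead of rows and backwards.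
infusion-sym : ∀ {us us′ : Vec Place m} {ts ts′ : Vec Place n} →
  Infusion us ts ts′ us′ → Infusion ts′ us′ us ts
infusion-sym {ts = []}     []      = []
infusion-sym {ts = t ∷ ts} []      = [] ∷ infusion-sym []
infusion-sym               (p ∷ i) = column p (infusion-sym i)
  where
  column : ∀ {m n u u′} {ts₁ ts₂ ts : Vec Place n} {us us′ : Vec Place m} →
    Pass u ts₁ ts₂ u′ → Infusion ts₁ us′ us ts → Infusion ts₂ (u′ ∷ us′) (u ∷ us) ts
  column []           []      = []
  column (trade adj p) (q ∷ i) = trade adj q ∷ column p i
  column (skip ¬adj p) (q ∷ i) = skip (¬adj ∘ Sum.swap) q ∷ column p i

-- The validity of a word is preserved when the place of • and the letters
-- it passes are exchanged.
pass-valid : ∀ {u u′} {ts ts′ : Vec Place m} {w : Vec Place n} → Pass u ts ts′ u′ →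
  Valid A (u ∷ (ts ++ w)) → Valid A (ts′ ++ (u′ ∷ w))
pass-valid []            v       = v
pass-valid (trade _ p)    (f ∷ v) = f ∷ pass-valid p v
pass-valid (skip ¬adj p) v with f ∷ v′ ← valid-commute ¬adj v = f ∷ pass-valid p v′

infusion-valid : ∀ {us us′ : Vec Place m} {ts ts′ : Vec Place n} → Infusion us ts ts′ us′ →
  Valid A (us ++ ts) → Valid A (ts′ ++ us′)
infusion-valid []      v       = valid-++[] v
infusion-valid (p ∷ i) (f ∷ v) = pass-valid p (f ∷ infusion-valid i v)

------------------------------------------------------------------------
-- A slide is a pass

-- The label x of the tableau T stands at the x-th letter of C.
record Represents {N} (T : Tableau N) (C : Vec Place N) : Set where
  field
    box⇒  : ∀ {q x} → box T q ≡ just x → lookup C x ≡ inBox q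
    box⇐  : ∀ {q x} → lookup C x ≡ inBox q → box T q ≡ just x
    edge⇒ : ∀ {i x} → x ∈ˢ edge T i → lookup C x ≡ onEdge i
    edge⇐ : ∀ {i x} → lookup C x ≡ onEdge i → x ∈ˢ edge T i

open Represents

inBox-injective : ∀ {p q} → inBox p ≡ inBox q → p ≡ q
inBox-injective refl = refl

onEdge-injective : ∀ {i j} → onEdge i ≡ onEdge j → i ≡ j
onEdge-injective refl = refl

inBox≢onEdge : ∀ {p i} → inBox p ≢ onEdge i
inBox≢onEdge ()

minimum-least : ∀ (S : Subset N) {s x} → minimum S ≡ just s → x ∈ˢ S → s Fin.≤ x
minimum-least (inside  ∷ S) refl _ = z≤n
minimum-least (outside ∷ S) eq (there x∈S) with minimum S in eqS
minimum-least (outside ∷ S) refl (there x∈S) | just s = s≤s (minimum-least S eqS x∈S)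

minimum-∈ : ∀ (S : Subset N) {s} → minimum S ≡ just s → s ∈ˢ S
minimum-∈ (inside  ∷ S) refl = here
minimum-∈ (outside ∷ S) eq with minimum S in eqS
minimum-∈ (outside ∷ S) refl | just s = there (minimum-∈ S eqS)

minimum-exists : ∀ (S : Subset N) {x} → x ∈ˢ S → ∃[ s ] minimum S ≡ just s
minimum-exists (inside  ∷ S) _           = zero , refl
minimum-exists (outside ∷ S) (there x∈S) =
  let s , eq = minimum-exists S x∈S in suc s , cong (Maybe.map suc) eq

minimum-unique : ∀ (S : Subset N) {s} → s ∈ˢ S → (∀ {x} → x ∈ˢ S → s Fin.≤ x) → minimum S ≡ just s
minimum-unique S s∈S s≤ =
  let s′ , eq = minimum-exists S s∈S
  in trans eq (cong just (Fin.≤-antisym (minimum-least S eq s∈S) (s≤ (minimum-∈ S eq))))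

minimum-empty : ∀ (S : Subset N) → (∀ x → x ∉ˢ S) → minimum S ≡ nothing
minimum-empty S empty with minimum S in eq
... | nothing = refl
... | just s  = contradiction (minimum-∈ S eq) (empty s)

move-diagonal : ∀ (T : Tableau N) i →
  move T (i , i) ≡ onDiagonal (box T (i , suc i)) (minimum (edge T i))
move-diagonal T i rewrite dec-true (i ℕ.≟ i) refl = refl

move-offDiagonal : ∀ (T : Tableau N) {i j} → i ≢ j →
  move T (i , j) ≡ offDiagonal (box T (i , suc j)) (box T (suc i , j))
move-offDiagonal T {i} {j} i≢j rewrite dec-false (i ℕ.≟ j) i≢j = refl

box-setBox-≡ : ∀ (T : Tableau N) p {x} → box (setBox p x T) p ≡ x
box-setBox-≡ T p {x} = cong (λ b → if b then x else box T p) (dec-true (p ≟ᴮ p) refl)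

box-setBox-≢ : ∀ (T : Tableau N) {p q x} → q ≢ p → box (setBox p x T) q ≡ box T q
box-setBox-≢ T {p} {q} {x} q≢p = cong (λ b → if b then x else box T q) (dec-false (q ≟ᴮ p) q≢p)

edge-setEdge-≡ : ∀ (T : Tableau N) i {S} → edge (setEdge i S T) i ≡ S
edge-setEdge-≡ T i {S} = cong (λ b → if b then S else edge T i) (dec-true (i ℕ.≟ i) refl)

edge-setEdge-≢ : ∀ (T : Tableau N) {i k S} → k ≢ i → edge (setEdge i S T) k ≡ edge T k
edge-setEdge-≢ T {i} {k} {S} k≢i = cong (λ b → if b then S else edge T k) (dec-false (k ℕ.≟ i) k≢i)

∈-─⇒∉ : ∀ (S S′ : Subset N) {x} → x ∈ˢ S ─ S′ → x ∉ˢ S′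
∈-─⇒∉ (inside ∷ S) (outside ∷ S′) here       ()
∈-─⇒∉ (_ ∷ S)      (_ ∷ S′)       (there x∈) (there x∈′) = ∈-─⇒∉ S S′ x∈ x∈′

∈-minus⇒≢ : ∀ (S : Subset N) {x y} → x ∈ˢ S - y → x ≢ y
∈-minus⇒≢ S {x} x∈ refl = ∈-─⇒∉ S _ x∈ (x∈⁅x⁆ x)

module _ {N : ℕ} {T : Tableau N} {C : Vec Place N} (rep : Represents T C) where

  box-empty : ∀ {q} → (∀ x → lookup C x ≢ inBox q) → box T q ≡ nothing
  box-empty {q} empty with box T q in eq
  ... | nothing = refl
  ... | just x  = contradiction (box⇒ rep eq) (empty x)

  sameBox : ∀ {q x y} → lookup C x ≡ inBox q → lookup C y ≡ inBox q → x ≡ y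
  sameBox Cx Cy = Maybe.just-injective (trans (sym (box⇐ rep Cx)) (box⇐ rep Cy))

  move-stop : ∀ {i j} → i ≤ j → (∀ x → ¬ inBox (i , j) ⋖ lookup C x) → move T (i , j) ≡ stop
  move-stop {i} {j} i≤j last with i ℕ.≟ j
  ... | yes refl rewrite move-diagonal T i
    | box-empty {i , suc i} (λ x Cx → last x (subst (_ ⋖_) (sym Cx) (left i≤j)))
    | minimum-empty (edge T i) (λ x x∈ → last x (subst (_ ⋖_) (sym (edge⇒ rep x∈)) atop)) = refl
  ... | no i≢j rewrite move-offDiagonal T i≢j
    | box-empty {i , suc j} (λ x Cx → last x (subst (_ ⋖_) (sym Cx) (left i≤j)))
    | box-empty {suc i , j} (λ x Cx → last x (subst (_ ⋖_) (sym Cx) (above (ℕ.≤∧≢⇒< i≤j i≢j)))) = refl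

  -- Here x is the least label that could move into (i , j).
  module _ {i j : ℕ} {x : Fin N} (least : ∀ y → inBox (i , j) ⋖ lookup C y → x Fin.≤ y) where

    move-right : i ≤ j → lookup C x ≡ inBox (i , suc j) → move T (i , j) ≡ goRight
    move-right i≤j Cx with i ℕ.≟ j
    move-right i≤j Cx | yes refl
      rewrite move-diagonal T i | box⇐ rep Cx with minimum (edge T i) in eq
    ... | nothing = refl
    ... | just s rewrite dec-true (x Fin.<? s) (Fin.≤∧≢⇒<
            (least s (subst (_ ⋖_) (sym (edge⇒ rep (minimum-∈ (edge T i) eq))) atop))
            λ { refl → inBox≢onEdge (trans (sym Cx) (edge⇒ rep (minimum-∈ (edge T i) eq))) }) = refl
    move-right i≤j Cx | no i≢j
      rewrite move-offDiagonal T i≢j | box⇐ rep Cx with box T (suc i , j) in eq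
    ... | nothing = refl
    ... | just b rewrite dec-false (b Fin.<? x) (ℕ.≤⇒≯ (least b
            (subst (_ ⋖_) (sym (box⇒ rep eq)) (above (ℕ.≤∧≢⇒< i≤j i≢j))))) = refl

    move-down : i < j → lookup C x ≡ inBox (suc i , j) → move T (i , j) ≡ goDown
    move-down i<j Cx rewrite move-offDiagonal T (ℕ.<⇒≢ i<j) | box⇐ rep Cx
      with box T (i , suc j) in eq
    ... | nothing = refl
    ... | just a rewrite dec-true (x Fin.<? a) (Fin.≤∧≢⇒<
            (least a (subst (_ ⋖_) (sym (box⇒ rep eq)) (left (ℕ.<⇒≤ i<j))))
            λ { refl → ℕ.1+n≢n (sym (cong proj₁ (inBox-injective (trans (sym (box⇒ rep eq)) Cx)))) }) = refl

  move-settle : ∀ {i x} → (∀ y → inBox (i , i) ⋖ lookup C y → x Fin.≤ y) →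
    lookup C x ≡ onEdge i → move T (i , i) ≡ settle x
  move-settle {i} {x} least Cx rewrite move-diagonal T i
    | minimum-unique (edge T i) (edge⇐ rep Cx)
        (λ {y} y∈ → least y (subst (_ ⋖_) (sym (edge⇒ rep y∈)) atop))
    with box T (i , suc i) in eq
  ... | nothing = refl
  ... | just a rewrite dec-false (a Fin.<? x) (ℕ.≤⇒≯ (least a
          (subst (_ ⋖_) (sym (box⇒ rep eq)) (left ℕ.≤-refl)))) = refl


-- The label x moves from the box q into the empty box p.
rep-swap : ∀ {T : Tableau N} {C x p q} → Represents T C → lookup C x ≡ inBox q →
  (∀ y → lookup C y ≢ inBox p) → Represents (swap p q T) (C [ x ]≔ inBox p)
rep-swap {T = T} {C} {x} {p} {q} rep Cx p-free = record
  { box⇒ = to ; box⇐ = from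
  ; edge⇒ = λ {i} y∈ → trans (unmoved (λ { refl → inBox≢onEdge (trans (sym Cx) (edge⇒ rep y∈)) })) (edge⇒ rep y∈)
  ; edge⇐ = λ {i} {y} Cy → edge⇐ rep (trans (sym (unmoved (λ { refl → inBox≢onEdge (trans (sym moved) Cy) }))) Cy) }
  where
  T₁ = setBox q nothing T
  moved : lookup (C [ x ]≔ inBox p) x ≡ inBox p
  moved = Vec.lookup∘update x C (inBox p)
  unmoved : ∀ {y} → y ≢ x → lookup (C [ x ]≔ inBox p) y ≡ lookup C y
  unmoved y≢x = Vec.lookup∘update′ y≢x C (inBox p)
  to : ∀ {r y} → box (swap p q T) r ≡ just y → lookup (C [ x ]≔ inBox p) y ≡ inBox r
  to {r} {y} eq with r ≟ᴮ p
  ... | yes refl with refl ← sameBox rep Cx (box⇒ rep eq) = moved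
  ... | no r≢p with r ≟ᴮ q
  ...   | no r≢q = trans (unmoved (λ { refl → r≢q (inBox-injective (trans (sym (box⇒ rep eq)) Cx)) })) (box⇒ rep eq)
  from : ∀ {r y} → lookup (C [ x ]≔ inBox p) y ≡ inBox r → box (swap p q T) r ≡ just y
  from {r} {y} eq with y Fin.≟ x
  ... | yes refl with refl ← trans (sym moved) eq = trans (box-setBox-≡ T₁ p) (box⇐ rep Cx)
  ... | no y≢x = trans (box-setBox-≢ T₁ (λ { refl → p-free y Cy }))
                (trans (box-setBox-≢ T (λ { refl → y≢x (sameBox rep Cy Cx) })) (box⇐ rep Cy))
    where Cy = trans (sym (unmoved y≢x)) eq

-- The label x moves from the edge i into the empty box p, as in (J4′).
rep-settle : ∀ {T : Tableau N} {C x p i} → Represents T C → lookup C x ≡ onEdge i →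
  (∀ y → lookup C y ≢ inBox p) →
  Represents (setEdge i (edge T i - x) (setBox p (just x) T)) (C [ x ]≔ inBox p)
rep-settle {T = T} {C} {x} {p} {i} rep Cx p-free = record
  { box⇒ = to ; box⇐ = from ; edge⇒ = edge-to ; edge⇐ = edge-from }
  where
  T₁ = setBox p (just x) T
  moved : lookup (C [ x ]≔ inBox p) x ≡ inBox p
  moved = Vec.lookup∘update x C (inBox p)
  unmoved : ∀ {y} → y ≢ x → lookup (C [ x ]≔ inBox p) y ≡ lookup C y
  unmoved y≢x = Vec.lookup∘update′ y≢x C (inBox p)
  to : ∀ {r y} → box T₁ r ≡ just y → lookup (C [ x ]≔ inBox p) y ≡ inBox r
  to {r} eq with r ≟ᴮ p
  ... | yes refl with refl ← eq = moved
  ... | no r≢p = trans (unmoved (λ { refl → inBox≢onEdge (trans (sym (box⇒ rep eq)) Cx) })) (box⇒ rep eq)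
  from : ∀ {r y} → lookup (C [ x ]≔ inBox p) y ≡ inBox r → box T₁ r ≡ just y
  from {r} {y} eq with y Fin.≟ x
  ... | yes refl with refl ← trans (sym moved) eq = box-setBox-≡ T p
  ... | no y≢x = trans (box-setBox-≢ T (λ { refl → p-free y Cy })) (box⇐ rep Cy)
    where Cy = trans (sym (unmoved y≢x)) eq
  edge-to : ∀ {k y} → y ∈ˢ edge (setEdge i (edge T i - x) T₁) k → lookup (C [ x ]≔ inBox p) y ≡ onEdge k
  edge-to {k} {y} y∈ with k ℕ.≟ i
  ... | yes refl = trans (unmoved (∈-minus⇒≢ (edge T i) y∈′)) (edge⇒ rep (p─q⊆p (edge T i) _ y∈′))
    where y∈′ = subst (y ∈ˢ_) (edge-setEdge-≡ T₁ i) y∈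
  ... | no k≢i = trans (unmoved (λ { refl → k≢i (onEdge-injective (trans (sym Cy) Cx)) })) Cy
    where Cy = edge⇒ rep (subst (y ∈ˢ_) (edge-setEdge-≢ T₁ k≢i) y∈)
  edge-from : ∀ {k y} → lookup (C [ x ]≔ inBox p) y ≡ onEdge k → y ∈ˢ edge (setEdge i (edge T i - x) T₁) k
  edge-from {k} {y} eq with y Fin.≟ x
  ... | yes refl with () ← trans (sym moved) eq
  ... | no y≢x with k ℕ.≟ i
  ...   | yes refl = subst (y ∈ˢ_) (sym (edge-setEdge-≡ T₁ i)) (x∈p∧x≢y⇒x∈p-y (edge⇐ rep Cy) y≢x)
    where Cy = trans (sym (unmoved y≢x)) eq
  ...   | no k≢i = subst (y ∈ˢ_) (sym (edge-setEdge-≢ T₁ k≢i)) (edge⇐ rep (trans (sym (unmoved y≢x)) eq))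

slideFrom-right : ∀ {T : Tableau N} {p} m → move T p ≡ goRight →
  slideFrom (suc m) p T ≡ slideFrom m (right p) (swap p (right p) T)
slideFrom-right m eq rewrite eq = refl

slideFrom-down : ∀ {T : Tableau N} {p} m → move T p ≡ goDown →
  slideFrom (suc m) p T ≡ slideFrom m (below p) (swap p (below p) T)
slideFrom-down m eq rewrite eq = refl

slideFrom-settle : ∀ {T : Tableau N} {p s} m → move T p ≡ settle s →
  slideFrom (suc m) p T ≡ setEdge (row p) (edge T (row p) - s) (setBox p (just s) T)
slideFrom-settle m eq rewrite eq = refl

slideFrom-stop : ∀ {T : Tableau N} {p} m → move T p ≡ stop →
  slideFrom (suc m) p T ≡ record T { outer = remove p (outer T) }
slideFrom-stop m eq rewrite eq = refl

-- • can move at most once into each box of the word that it has yet to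
-- pass, so this number bounds the remaining steps of a slide.
boxCount : Vec Place n → ℕ
boxCount []             = 0
boxCount (inBox _  ∷ w) = suc (boxCount w)
boxCount (onEdge _ ∷ w) = boxCount w

boxCount-tail : ∀ x (w : Vec Place n) → boxCount w ≤ boxCount (x ∷ w)
boxCount-tail (inBox _)  w = ℕ.n≤1+n _
boxCount-tail (onEdge _) w = ℕ.≤-refl

-- The outer shape once • has ended in the given place.
vacate : Place → Shape → Shape
vacate (inBox p)  ps = remove p ps
vacate (onEdge _) ps = ps

-- An occupied box does not receive another label.
valid-fresh : ∀ {w : Vec Place n} {x} → Valid A w → IsBox x → A x → ∀ k → lookup w k ≢ x
valid-fresh (f ∷ v) b Ax zero    refl = fresh f b Ax
valid-fresh (f ∷ v) b Ax (suc k) eq   = valid-fresh v b (inj₂ Ax) k eq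

-- A • on an edge stays there: the only place adjacent to it is a box that
-- has already been filled.
pass-onEdge : ∀ {i} {ts ts′ : Vec Place n} {u′} → A (inBox (i , i)) → Valid A ts →
  Pass (onEdge i) ts ts′ u′ → ts′ ≡ ts × u′ ≡ onEdge i
pass-onEdge Ai []      []                    = refl , refl
pass-onEdge Ai (f ∷ v) (trade (inj₂ atop) _) = contradiction Ai (fresh f tt)
pass-onEdge Ai (f ∷ v) (skip _ p) with refl , refl ← pass-onEdge (inj₂ Ai) v p = refl , refl

-- T′ is the result of moving the labels e 0 , e 1 , … of T from their
-- places in C to the letters of w, with • ending in u.
record Slid {N n} (T T′ : Tableau N) (C : Vec Place N) (e : Fin n → Fin N)
            (w : Vec Place n) (u : Place) : Set where
  field
    places      : Vec Place N
    represented : Represents T′ places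
    moved       : ∀ k → lookup places (e k) ≡ lookup w k
    unmoved     : ∀ x → (∀ k → x ≢ e k) → lookup places x ≡ lookup C x
    inner-same  : inner T′ ≡ inner T
    outer-less  : outer T′ ≡ vacate u (outer T)

-- The labels e 0 < e 1 < … , at the letters ts, are those not yet passed
-- by •, which is in p; the other labels have their places in A.  Since A
-- is closed under predecessors and does not contain p, the labels right of
-- p, below p or on the edge of p are among the former; the first of these
-- in the word is the least one, and so the one that the next step moves.
slide-correct : ∀ {p} {ts ts′ : Vec Place n} {u′} {T : Tableau N} {C} (e : Fin n → Fin N) m →
  boxCount ts < m → (∀ {k l} → k Fin.< l → e k Fin.< e l) →
  Closed A → Valid A (inBox p ∷ ts) → Pass (inBox p) ts ts′ u′ → Represents T C →
  (∀ k → lookup C (e k) ≡ lookup ts k) →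
  (∀ x → (∃[ k ] x ≡ e k) ⊎ A (lookup C x)) →
  Slid T (slideFrom m p T) C e ts′ u′
slide-correct {A = A} {p = i , j} {[]} {T = T} {C} e (suc m) _ mono cl (f ∷ v) [] rep C-e processed = record
  { places = C ; represented = record { box⇒ = box⇒ rep′ ; box⇐ = box⇐ rep′ ; edge⇒ = edge⇒ rep′ ; edge⇐ = edge⇐ rep′ }
  ; moved = λ () ; unmoved = λ _ _ → refl
  ; inner-same = cong inner eq ; outer-less = cong outer eq }
  where
  none-left : ∀ x → ¬ inBox (i , j) ⋖ lookup C x
  none-left x p⋖x with inj₂ Ax ← processed x = fresh f tt (cl p⋖x Ax)
  eq = slideFrom-stop m (move-stop rep (upperTriangular f) none-left)
  rep′ : Represents (slideFrom (suc m) (i , j) T) C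
  rep′ = subst (λ T′ → Represents T′ C) (sym eq)
    (record { box⇒ = box⇒ rep ; box⇐ = box⇐ rep ; edge⇒ = edge⇒ rep ; edge⇐ = edge⇐ rep })
slide-correct {A = A} {ts = t ∷ ts} {T = T} {C} e m short mono cl v (skip ¬adj pass) rep C-e processed = record
  { places = places ; represented = represented
  ; moved = λ { zero → trans (unmoved (e zero) (λ k eq → Fin.<-irrefl eq (mono (s≤s z≤n)))) (C-e zero)
              ; (suc k) → moved k }
  ; unmoved = λ x x≢ → unmoved x (λ k → x≢ (suc k))
  ; inner-same = inner-same ; outer-less = outer-less }
  where
  swapped = valid-commute ¬adj v
  fit : Fits A t
  fit with f ∷ _ ← swapped = f
  rest : Valid (A ∙ t) (inBox _ ∷ ts)
  rest with _ ∷ v′ ← swapped = v′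
  processed′ : ∀ x → (∃[ k ] x ≡ e (suc k)) ⊎ (A ∙ t) (lookup C x)
  processed′ x with processed x
  ... | inj₁ (zero , refl)  = inj₂ (inj₁ (C-e zero))
  ... | inj₁ (suc k , x≡)   = inj₁ (k , x≡)
  ... | inj₂ Ax             = inj₂ (inj₂ Ax)
  open Slid (slide-correct (e ∘ suc) m (ℕ.≤-<-trans (boxCount-tail t ts) short) (mono ∘ s≤s)
    (closed-∙ cl fit) rest pass rep (C-e ∘ suc) processed′)
slide-correct e m short mono cl (f ∷ g ∷ v) (trade (inj₂ t⋖p) _) rep C-e processed =
  contradiction (inj₂ (preceded f t⋖p)) (fresh g (⋖⇒IsBox t⋖p))
slide-correct {n = suc n} {N = N} {A = A} {p = p@(i , j)} {t ∷ ts} {u ∷ ts′} {u′} {T = T} {C} e (suc m) short mono cl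
  (f ∷ v@(g ∷ v₁)) (trade (inj₁ p⋖t) pass) rep C-e processed = step p⋖t refl short pass
  where
  -- The label that moves into p.
  x₀ = e zero

  least : ∀ y → inBox p ⋖ lookup C y → x₀ Fin.≤ y
  least y p⋖y with processed y
  ... | inj₁ (zero , refl)  = Fin.≤-refl
  ... | inj₁ (suc k , refl) = ℕ.<⇒≤ (mono {zero} {suc k} (s≤s z≤n))
  ... | inj₂ Ay             = contradiction (cl p⋖y Ay) (fresh f tt)

  p-free : ∀ y → lookup C y ≢ inBox p
  p-free y eq with processed y
  ... | inj₁ (k , refl) = valid-fresh v tt (inj₁ refl) k (trans (sym (C-e k)) eq)
  ... | inj₂ Ay         = fresh f tt (subst A eq Ay)

  C₁ = C [ x₀ ]≔ inBox p

  C₁-x₀ : lookup C₁ x₀ ≡ inBox p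
  C₁-x₀ = Vec.lookup∘update x₀ C (inBox p)

  C₁-other : ∀ {x} → x ≢ x₀ → lookup C₁ x ≡ lookup C x
  C₁-other x≢x₀ = Vec.lookup∘update′ x≢x₀ C (inBox p)

  x₀≢e : ∀ k → x₀ ≢ e (suc k)
  x₀≢e k eq = Fin.<-irrefl eq (mono (s≤s z≤n))

  processed₁ : ∀ x → (∃[ k ] x ≡ e (suc k)) ⊎ (A ∙ inBox p) (lookup C₁ x)
  processed₁ x with processed x
  ... | inj₁ (zero , refl)  = inj₂ (inj₁ C₁-x₀)
  ... | inj₁ (suc k , x≡)   = inj₁ (k , x≡)
  ... | inj₂ Ax with x Fin.≟ x₀
  ...   | yes refl = inj₂ (inj₁ C₁-x₀)
  ...   | no x≢x₀  = inj₂ (inj₂ (subst A (sym (C₁-other x≢x₀)) Ax))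

  extend : ∀ {T′} q → Slid (swap p q T) T′ C₁ (e ∘ suc) ts′ u′ → Slid T T′ C e (inBox p ∷ ts′) u′
  extend q s = record
    { places = places ; represented = represented
    ; moved = λ { zero → trans (unmoved x₀ x₀≢e) C₁-x₀ ; (suc k) → moved k }
    ; unmoved = λ x x≢ → trans (unmoved x (λ k → x≢ (suc k))) (C₁-other (x≢ zero))
    ; inner-same = inner-same ; outer-less = outer-less }
    where open Slid s

  -- • moves into the box q.
  continue : ∀ q → t ≡ inBox q → boxCount (t ∷ ts) < suc m → Pass t ts ts′ u′ →
    slideFrom (suc m) p T ≡ slideFrom m q (swap p q T) →
    Slid T (slideFrom (suc m) p T) C e (inBox p ∷ ts′) u′
  continue q refl (s≤s short′) pass′ eq = subst (λ T′ → Slid T T′ C e (inBox p ∷ ts′) u′) (sym eq)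
    (extend q (slide-correct (e ∘ suc) m short′ (mono ∘ s≤s) (closed-∙ cl f) v pass′
      (rep-swap rep (C-e zero) p-free)
      (λ k → trans (C₁-other (λ eq → x₀≢e k (sym eq))) (C-e (suc k))) processed₁))

  step : ∀ {t′} → inBox p ⋖ t′ → t ≡ t′ → boxCount (t ∷ ts) < suc m → Pass t ts ts′ u′ →
    Slid T (slideFrom (suc m) p T) C e (inBox p ∷ ts′) u′
  step (left i≤j) t≡ sh pass′ = continue (right p) t≡ sh pass′
    (slideFrom-right m (move-right rep least i≤j (trans (C-e zero) t≡)))
  step (above i<j) t≡ sh pass′ = continue (below p) t≡ sh pass′
    (slideFrom-down m (move-down rep least i<j (trans (C-e zero) t≡)))
  step atop refl sh pass′ with refl , refl ← pass-onEdge (inj₂ (inj₁ refl)) v₁ pass′ = record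
    { places = C₁ ; represented = subst (λ T′ → Represents T′ C₁) (sym eq) (rep-settle rep (C-e zero) p-free)
    ; moved = λ { zero → C₁-x₀ ; (suc k) → trans (C₁-other (λ eq → x₀≢e k (sym eq))) (C-e (suc k)) }
    ; unmoved = λ x x≢ → C₁-other (x≢ zero)
    ; inner-same = cong inner eq ; outer-less = cong outer eq }
    where
    eq = slideFrom-settle m (move-settle rep least (C-e zero))

------------------------------------------------------------------------
-- Shapes in reading order

infix 4 _≺_

-- Strict English reading order.
_≺_ : Box → Box → Set
(i , j) ≺ (k , l) = i < k ⊎ (i ≡ k × j < l)

≺-asym : ∀ {p q} → p ≺ q → ¬ q ≺ p
≺-asym (inj₁ i<k)         (inj₁ k<i)          = ℕ.<-asym i<k k<i
≺-asym (inj₁ i<k)         (inj₂ (refl , _))   = ℕ.<-irrefl refl i<k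
≺-asym (inj₂ (refl , _))  (inj₁ k<i)          = ℕ.<-irrefl refl k<i
≺-asym (inj₂ (refl , j<l)) (inj₂ (_ , l<j))   = ℕ.<-asym j<l l<j

≺-right : ∀ p → p ≺ right p
≺-right _ = inj₂ (refl , ℕ.≤-refl)

≺-below : ∀ p → p ≺ below p
≺-below _ = inj₁ ℕ.≤-refl

Sorted : Shape → Set
Sorted = AllPairs _≺_

sorted-head : ∀ {p ps} → Sorted (p ∷ ps) → p ∉ ps
sorted-head (p≺ ∷ _) p∈ = let p≺p = All.lookup p≺ p∈ in ≺-asym p≺p p≺p

-- A shape in reading order is determined by its set of boxes.
sorted-≡ : ∀ {ps qs} → Sorted ps → Sorted qs →
  (∀ p → p ∈ ps → p ∈ qs) → (∀ p → p ∈ qs → p ∈ ps) → ps ≡ qs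
sorted-≡ {[]}     {[]}     _ _ _ _ = refl
sorted-≡ {[]}     {q ∷ qs} _ _ _ from with () ← from q (here refl)
sorted-≡ {p ∷ ps} {[]}     _ _ to _ with () ← to p (here refl)
sorted-≡ {p ∷ ps} {q ∷ qs} sp@(p≺ ∷ sps) sq@(q≺ ∷ sqs) to from with heads
  where
  heads : p ≡ q
  heads with to p (here refl) | from q (here refl)
  ... | here p≡q   | _          = p≡q
  ... | there _    | here q≡p   = sym q≡p
  ... | there p∈qs | there q∈ps = contradiction (All.lookup p≺ q∈ps) (≺-asym (All.lookup q≺ p∈qs))
... | refl = cong (p ∷_) (sorted-≡ sps sqs (λ r → tails sp (to r)) (λ r → tails sq (from r)))
  where
  tails : ∀ {r rs rs′} → Sorted (p ∷ rs) → (r ∈ p ∷ rs → r ∈ p ∷ rs′) → r ∈ rs → r ∈ rs′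
  tails s f r∈ with f (there r∈)
  ... | here refl  = contradiction r∈ (sorted-head s)
  ... | there r∈′ = r∈′

-- The last box in reading order is the southmost inner corner.
module _ {pre : Shape} {b : Box} (s : Sorted (pre List.++ b ∷ [])) where

  private
    before : ∀ {pre} → Sorted (pre List.++ b ∷ []) → ∀ {q} → q ∈ pre → q ≺ b
    before {_ ∷ pre} (p≺ ∷ _) (here refl) = All.lookup p≺ (∈-++⁺ʳ pre (here refl))
    before (_ ∷ s)  (there q∈)  = before s q∈

    not-after : ∀ {q} → b ≺ q → q ∉ pre List.++ b ∷ []
    not-after b≺q q∈ with ∈-++⁻ pre q∈
    ... | inj₁ q∈pre       = ≺-asym b≺q (before s q∈pre)
    ... | inj₂ (here refl) = ≺-asym b≺q b≺q

    last-∷ʳ : ∀ (ps : Shape) → last (ps List.++ b ∷ []) ≡ just b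
    last-∷ʳ []           = refl
    last-∷ʳ (_ ∷ [])     = refl
    last-∷ʳ (_ ∷ q ∷ ps) = last-∷ʳ (q ∷ ps)

  southmost-last : southmostInnerCorner (pre List.++ b ∷ []) ≡ just b
  southmost-last = trans
    (cong last (trans (List.filter-++ corner? pre (b ∷ []))
      (cong (filter corner? pre List.++_) (List.filter-accept corner?
        (∈-++⁺ʳ pre (here refl) , not-after (≺-right b) , not-after (≺-below b))))))
    (last-∷ʳ (filter corner? pre))
    where corner? = isInnerCorner? (pre List.++ b ∷ [])

  remove-last : remove b (pre List.++ b ∷ []) ≡ pre
  remove-last = trans (List.filter-++ ≢b? pre (b ∷ []))
    (trans (cong₂ List._++_ (List.filter-all ≢b? (All.tabulate λ q∈ → λ { refl → ≺-asym (before s q∈) (before s q∈) }))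
                            (List.filter-reject ≢b? (λ b≢b → b≢b refl)))
           (List.++-identityʳ pre))
    where ≢b? = λ p → ¬? (p ≟ᴮ b)

∈-remove⁺ : ∀ {p c ps} → p ∈ ps → p ≢ c → p ∈ remove c ps
∈-remove⁺ = ∈-filter⁺ _

∈-remove⁻ : ∀ {p c} ps → p ∈ remove c ps → p ∈ ps × p ≢ c
∈-remove⁻ ps = ∈-filter⁻ _ {xs = ps}

------------------------------------------------------------------------
-- Rectification is infusion

-- The boxes of a valid word are distinct, so a shape containing them has at
-- least as many boxes.  Hence the size of the outer shape suffices as a
-- bound on the steps of a slide.
boxCount-≤ : ∀ {w : Vec Place n} {ps} → Valid A w → (∀ {q} → inBox q Vec.∈ w → q ∈ ps) →
  boxCount w ≤ length ps
boxCount-≤ [] _ = z≤n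
boxCount-≤ {w = onEdge _ ∷ w} (_ ∷ v) w⊆ = boxCount-≤ v (w⊆ ∘ there)
boxCount-≤ {w = inBox p ∷ w} {ps} (_ ∷ v) w⊆ = ℕ.≤-<-trans
  (boxCount-≤ v λ q∈ → ∈-remove⁺ (w⊆ (there q∈))
    (λ { refl → valid-fresh v tt (inj₁ refl) (VecAny.index q∈) (sym (VecAnyP.lookup-index q∈)) }))
  (List.filter-notAll _ ps (lose (w⊆ (here refl)) (λ p≢p → p≢p refl)))

pass-∈⁺ : ∀ {u u′ z} {ts ts′ : Vec Place n} → Pass u ts ts′ u′ →
  z Vec.∈ (u ∷ ts) → z ≡ u′ ⊎ z Vec.∈ ts′
pass-∈⁺ []         (here refl)         = inj₁ refl
pass-∈⁺ (trade _ p) (here refl)         = inj₂ (here refl)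
pass-∈⁺ (trade _ p) (there z∈)          = Sum.map₂ there (pass-∈⁺ p z∈)
pass-∈⁺ (skip _ p) (here refl)         = Sum.map₂ there (pass-∈⁺ p (here refl))
pass-∈⁺ (skip _ p) (there (here refl)) = inj₂ (here refl)
pass-∈⁺ (skip _ p) (there (there z∈))  = Sum.map₂ there (pass-∈⁺ p (there z∈))

pass-∈⁻ : ∀ {u u′ z} {ts ts′ : Vec Place n} → Pass u ts ts′ u′ →
  z Vec.∈ ts′ → z Vec.∈ (u ∷ ts)
pass-∈⁻ (trade _ p) (here refl) = here refl
pass-∈⁻ (trade _ p) (there z∈)  = there (pass-∈⁻ p z∈)
pass-∈⁻ (skip _ p) (here refl) = there (here refl)
pass-∈⁻ (skip _ p) (there z∈) with pass-∈⁻ p z∈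
... | here refl = here refl
... | there z∈′ = there (there z∈′)

valid-last : ∀ {w : Vec Place n} {x} → Valid A (w ++ x ∷ []) → IsBox x → ¬ A x × ¬ x Vec.∈ w
valid-last {w = []}    (f ∷ []) b = fresh f b , λ ()
valid-last {w = y ∷ w} (f ∷ v)  b with ¬Ax , x∉w ← valid-last v b =
  (¬Ax ∘ inj₂) , λ { (here refl) → ¬Ax (inj₁ refl) ; (there x∈) → x∉w x∈ }

-- The shape ps consists of the boxes in A and in w, in reading order.
record Outer (A : Places) (w : Vec Place n) (ps : Shape) : Set where
  field
    sorted    : Sorted ps
    complete  : ∀ {q} → A (inBox q) ⊎ inBox q Vec.∈ w → q ∈ ps
    sound     : ∀ {q} → q ∈ ps → A (inBox q) ⊎ inBox q Vec.∈ w

open Outer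

-- A slide removes from the outer shape the box in which • ends, if any.
outer-vacate : ∀ {u u′} {ts ts′ : Vec Place n} {ps} → Valid A (u ∷ ts) → Pass u ts ts′ u′ →
  Outer A (u ∷ ts) ps → Outer A ts′ (vacate u′ ps)
outer-vacate {u = u} {u′ = onEdge i} v p o = record
  { sorted = sorted o
  ; complete = λ { (inj₁ Aq) → complete o (inj₁ Aq) ; (inj₂ q∈) → complete o (inj₂ (pass-∈⁻ p q∈)) }
  ; sound = λ q∈ → Sum.map₂ (λ q∈w → [ (λ ()) , id ]′ (pass-∈⁺ p q∈w)) (sound o q∈) }
outer-vacate {u′ = inBox c} {ps = ps} (f ∷ v) p o = record
  { sorted = AllPairs.filter⁺ _ (sorted o)
  ; complete = λ { (inj₁ Aq) → ∈-remove⁺ (complete o (inj₁ Aq)) (λ { refl → proj₁ c-new Aq })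
                 ; (inj₂ q∈) → ∈-remove⁺ (complete o (inj₂ (pass-∈⁻ p q∈))) (λ { refl → proj₂ c-new q∈ }) }
  ; sound = λ q∈ → let q∈ps , q≢c = ∈-remove⁻ ps q∈ in Sum.map₂
      (λ q∈w → [ (λ { refl → contradiction refl q≢c }) , id ]′ (pass-∈⁺ p q∈w)) (sound o q∈ps) }
  where
  c-new = valid-last (pass-valid p (f ∷ valid-++[] v)) tt

lookup-ext : ∀ {A : Set} (w w′ : Vec A n) → (∀ k → lookup w k ≡ lookup w′ k) → w ≡ w′
lookup-ext []      []        _  = refl
lookup-ext (x ∷ w) (x′ ∷ w′) eq = cong₂ _∷_ (eq zero) (lookup-ext w w′ (eq ∘ suc))

slides-suc : ∀ k (T : Tableau N) → slides (suc k) T ≡ slideSouthmost (slides k T)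
slides-suc zero    T = refl
slides-suc (suc k) T = slides-suc k (slideSouthmost T)

slideSouthmost-just : ∀ (T : Tableau N) {c} → southmostInnerCorner (inner T) ≡ just c → slideSouthmost T ≡ shEjdt c T
slideSouthmost-just T eq rewrite eq = refl

-- T carries its labels at C, around the inner shape pre; the boxes of the
-- outer shape are those of A and of C.
record Rectified (A : Places) (pre : Shape) (C : Vec Place N) (T : Tableau N) : Set where
  field
    represented : Represents T C
    inner-pre   : inner T ≡ pre
    outer-boxes : Outer A C (outer T)

-- The slides into the boxes bs, which follow pre in the reading order of
-- the inner shape, perform an infusion of bs with the labels of T.
rectify-correct : ∀ (pre : Shape) (bs : Vec Box m) {T : Tableau N} {C C′ us′} →
  Sorted (pre List.++ Vec.toList bs) → inner T ≡ pre List.++ Vec.toList bs → Closed A →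
  Valid A (Vec.map inBox bs ++ C) → Infusion (Vec.map inBox bs) C C′ us′ →
  Represents T C → Outer A (Vec.map inBox bs ++ C) (outer T) →
  Rectified A pre C′ (slides m T)
rectify-correct pre [] s inner≡ cl v [] rep out =
  record { represented = rep ; inner-pre = trans inner≡ (List.++-identityʳ pre) ; outer-boxes = out }
rectify-correct {m = suc m} {A = A} pre (b ∷ bs) {T} {C} {C′} s inner≡ cl (f ∷ v) (_∷_ {u′ = u′} {ts₁ = C₁} pass inf) rep out =
  subst (Rectified A pre C′) (sym (trans (slides-suc m T) (slideSouthmost-just T₁
          (trans (cong southmostInnerCorner inner-pre) (southmost-last s′)))))
    record { represented = subst (Represents T₂) (lookup-ext places C′ moved) Slide.represented
           ; inner-pre = trans inner-same (trans (cong (remove b) inner-pre) (remove-last s′))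
           ; outer-boxes = subst (Outer A C′) (sym outer-less) (outer-vacate v₁ pass out₁) }
  where
  reassoc : pre List.++ b ∷ Vec.toList bs ≡ (pre List.++ b ∷ []) List.++ Vec.toList bs
  reassoc = sym (List.++-assoc pre (b ∷ []) (Vec.toList bs))

  T₁ = slides m T

  IH : Rectified (A ∙ inBox b) (pre List.++ b ∷ []) C₁ T₁
  IH = rectify-correct (pre List.++ b ∷ []) bs (subst Sorted reassoc s) (trans inner≡ reassoc)
    (closed-∙ cl f) v inf rep record
      { sorted = sorted out
      ; complete = λ { (inj₁ (inj₁ refl)) → complete out (inj₂ (here refl))
                     ; (inj₁ (inj₂ Aq))   → complete out (inj₁ Aq)
                     ; (inj₂ q∈)          → complete out (inj₂ (there q∈)) }
      ; sound = λ q∈ → case-sound (sound out q∈) }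
    where
    case-sound : ∀ {z} {w : Vec Place n} → A z ⊎ z Vec.∈ (inBox b ∷ w) → (A ∙ inBox b) z ⊎ z Vec.∈ w
    case-sound (inj₁ Az)          = inj₁ (inj₂ Az)
    case-sound (inj₂ (here refl)) = inj₁ (inj₁ refl)
    case-sound (inj₂ (there z∈))  = inj₂ z∈
  open Rectified IH

  s′ : Sorted (pre List.++ b ∷ [])
  s′ = sorted-prefix (pre List.++ b ∷ []) (subst Sorted reassoc s)
    where
    sorted-prefix : ∀ ps {qs} → Sorted (ps List.++ qs) → Sorted ps
    sorted-prefix []       _        = []
    sorted-prefix (p ∷ ps) (p≺ ∷ s) = All.tabulate (λ q∈ → All.lookup p≺ (∈-++⁺ˡ q∈)) ∷ sorted-prefix ps s

  v₁ : Valid A (inBox b ∷ C₁)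
  v₁ = f ∷ valid-prefix (infusion-valid inf v)

  out₁ : Outer A (inBox b ∷ C₁) (outer T₁)
  out₁ = record
    { sorted = sorted outer-boxes
    ; complete = λ { (inj₁ Aq) → complete outer-boxes (inj₁ (inj₂ Aq))
                   ; (inj₂ (here refl)) → complete outer-boxes (inj₁ (inj₁ refl))
                   ; (inj₂ (there q∈)) → complete outer-boxes (inj₂ q∈) }
    ; sound = λ q∈ → case-sound (sound outer-boxes q∈) }
    where
    case-sound : ∀ {z} {w : Vec Place n} → (A ∙ inBox b) z ⊎ z Vec.∈ w → A z ⊎ z Vec.∈ (inBox b ∷ w)
    case-sound (inj₁ (inj₁ refl)) = inj₂ (here refl)
    case-sound (inj₁ (inj₂ Az))   = inj₁ Az
    case-sound (inj₂ z∈)          = inj₂ (there z∈)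

  T₂ = shEjdt b T₁

  short : boxCount C₁ < length (outer T₁)
  short = boxCount-≤ v₁ (λ q∈ → complete out₁ (inj₂ q∈))

  started : Represents (record T₁ { inner = remove b (inner T₁) }) C₁
  started = record { box⇒ = box⇒ represented ; box⇐ = box⇐ represented
                   ; edge⇒ = edge⇒ represented ; edge⇐ = edge⇐ represented }

  module Slide = Slid (slide-correct id (length (outer T₁)) short id cl v₁ pass started (λ _ → refl) (λ x → inj₁ (x , refl)))
  open Slide using (places; moved; inner-same; outer-less)

open Rectified

------------------------------------------------------------------------
-- Shifted shapes of strict partitions

-- The p boxes of row r.
firstRow : ∀ r p → Vec Box p
firstRow r p = Vec.tabulate (λ k → r , r + toℕ k)

∈-boxesFrom⁻ : ∀ {i j} r p ps → (i , j) Vec.∈ boxesFrom r (p ∷ ps) →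
  (i ≡ r × r ≤ j × j < r + p) ⊎ (i , j) Vec.∈ boxesFrom (suc r) ps
∈-boxesFrom⁻ r p ps ij∈ with VecAnyP.++⁻ (firstRow r p) ij∈
... | inj₂ ij∈rest = inj₂ ij∈rest
... | inj₁ ij∈row with k , refl ← VecAnyP.tabulate⁻ ij∈row =
  inj₁ (refl , ℕ.m≤m+n r (toℕ k) , ℕ.+-monoʳ-< r (Fin.toℕ<n k))

∈-boxesFrom⁺ : ∀ {j} r p ps → r ≤ j → j < r + p → (r , j) Vec.∈ boxesFrom r (p ∷ ps)
∈-boxesFrom⁺ {j} r p ps r≤j j<r+p = VecMem.∈-++⁺ˡ (subst (λ c → (r , c) Vec.∈ firstRow r p) r+k≡j
    (VecMem.∈-tabulate⁺ (λ (k : Fin p) → r , r + toℕ k) (Fin.fromℕ< k<p)))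
  where
  k<p : j ℕ.∸ r < p
  k<p = ℕ.+-cancelˡ-< r _ _ (subst (_< r + p) (sym (ℕ.m+[n∸m]≡n r≤j)) j<r+p)
  r+k≡j : r + toℕ (Fin.fromℕ< k<p) ≡ j
  r+k≡j = trans (cong (λ k → r + k) (Fin.toℕ-fromℕ< k<p)) (ℕ.m+[n∸m]≡n r≤j)

boxesFrom-row : ∀ {i j} r ps → (i , j) Vec.∈ boxesFrom r ps → r ≤ i
boxesFrom-row r (p ∷ ps) ij∈ with ∈-boxesFrom⁻ r p ps ij∈
... | inj₁ (refl , _) = ℕ.≤-refl
... | inj₂ ij∈′       = ℕ.<⇒≤ (boxesFrom-row (suc r) ps ij∈′)

boxesFrom-upper : ∀ {i j} r ps → (i , j) Vec.∈ boxesFrom r ps → i ≤ j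
boxesFrom-upper r (p ∷ ps) ij∈ with ∈-boxesFrom⁻ r p ps ij∈
... | inj₁ (refl , r≤j , _) = r≤j
... | inj₂ ij∈′             = boxesFrom-upper (suc r) ps ij∈′

boxesFrom-left : ∀ {i j} r ps → i ≤ j → (i , suc j) Vec.∈ boxesFrom r ps → (i , j) Vec.∈ boxesFrom r ps
boxesFrom-left r (p ∷ ps) i≤j ij∈ with ∈-boxesFrom⁻ r p ps ij∈
... | inj₁ (refl , _ , j<) = ∈-boxesFrom⁺ r p ps i≤j (ℕ.<⇒≤ j<)
... | inj₂ ij∈′ = VecMem.∈-++⁺ʳ (firstRow r p) (boxesFrom-left (suc r) ps i≤j ij∈′)

-- Strictness makes the rows of a shifted shape end weakly further right
-- than the rows below them.
boxesFrom-above : ∀ {i j} r {ps} → Linked _>_ ps → r ≤ i → (suc i , j) Vec.∈ boxesFrom r ps → (i , j) Vec.∈ boxesFrom r ps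
boxesFrom-above {i} {j} r {p ∷ ps} strict r≤i ij∈ with ∈-boxesFrom⁻ r p ps ij∈
... | inj₁ (refl , _) = contradiction r≤i (ℕ.<-irrefl refl)
boxesFrom-above {i} {j} r {p ∷ q ∷ ps} (p>q ∷ strict) r≤i ij∈ | inj₂ ij∈′ with r ℕ.≟ i
... | no r≢i = VecMem.∈-++⁺ʳ (firstRow r p)
                 (boxesFrom-above (suc r) strict (ℕ.≤∧≢⇒< r≤i r≢i) ij∈′)
... | yes refl with ∈-boxesFrom⁻ (suc r) q ps ij∈′
...   | inj₁ (_ , r<j , j<) = ∈-boxesFrom⁺ r p (q ∷ ps) (ℕ.<⇒≤ r<j)
          (ℕ.<-≤-trans j< (subst (_≤ r + p) (ℕ.+-suc r q) (ℕ.+-monoʳ-≤ r p>q)))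
...   | inj₂ ij∈″ = contradiction (boxesFrom-row (suc (suc r)) ps ij∈″) (ℕ.<-irrefl refl)

sorted-tabulate : ∀ (f : Fin n → Box) → (∀ {k l} → k Fin.< l → f k ≺ f l) → Sorted (Vec.toList (Vec.tabulate f))
sorted-tabulate {zero}  f _    = []
sorted-tabulate {suc n} f mono = All.tabulate (λ q∈ → first (VecMem.∈-toList⁻ q∈)) ∷ sorted-tabulate (f ∘ suc) (mono ∘ s≤s)
  where
  first : ∀ {q} → q Vec.∈ Vec.tabulate (f ∘ suc) → f zero ≺ q
  first q∈ with k , refl ← VecAnyP.tabulate⁻ q∈ = mono (s≤s z≤n)

boxesFrom-sorted : ∀ r ps → Sorted (Vec.toList (boxesFrom r ps))
boxesFrom-sorted r []       = []
boxesFrom-sorted r (p ∷ ps) = subst Sorted (sym (Vec.toList-++ (firstRow r p) (boxesFrom (suc r) ps)))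
  (AllPairs.++⁺ (sorted-tabulate _ (λ k<l → inj₂ (refl , ℕ.+-monoʳ-< r k<l))) (boxesFrom-sorted (suc r) ps)
    (All.tabulate λ q∈ → All.tabulate λ q∈′ → rows (VecMem.∈-toList⁻ q∈) (VecMem.∈-toList⁻ q∈′)))
  where
  rows : ∀ {q q′} → q Vec.∈ firstRow r p → q′ Vec.∈ boxesFrom (suc r) ps → q ≺ q′
  rows q∈ q′∈ with k , refl ← VecAnyP.tabulate⁻ q∈ = inj₁ (boxesFrom-row (suc r) ps q′∈)

boxesFrom-diagonal⁺ : ∀ r {ps} → All (0 <_) ps → ∀ {i} → i < length ps → (r + i , r + i) Vec.∈ boxesFrom r ps
boxesFrom-diagonal⁺ r {p ∷ ps} (0<p ∷ _) {zero} _ rewrite ℕ.+-identityʳ r =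
  ∈-boxesFrom⁺ r p ps ℕ.≤-refl (ℕ.m<m+n r 0<p)
boxesFrom-diagonal⁺ r {p ∷ ps} (_ ∷ pos) {suc i} (s≤s i<) rewrite ℕ.+-suc r i =
  VecMem.∈-++⁺ʳ (firstRow r p) (boxesFrom-diagonal⁺ (suc r) pos i<)

boxesFrom-rows : ∀ {i j} r ps → (i , j) Vec.∈ boxesFrom r ps → i < r + length ps
boxesFrom-rows r (p ∷ ps) ij∈ with ∈-boxesFrom⁻ r p ps ij∈
... | inj₁ (refl , _) = ℕ.m<m+n r (s≤s z≤n)
... | inj₂ ij∈′ rewrite ℕ.+-suc r (length ps) = boxesFrom-rows (suc r) ps ij∈′

shape-sorted : ∀ κ → Sorted (shape κ)
shape-sorted κ = boxesFrom-sorted 0 (parts κ)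

shape-upper : ∀ κ {i j} → (i , j) ∈ shape κ → i ≤ j
shape-upper κ = boxesFrom-upper 0 (parts κ) ∘ VecMem.∈-toList⁻

diagonal∈shape : ∀ κ {i} → i < ℓ κ → (i , i) ∈ shape κ
diagonal∈shape κ i< = VecMem.∈-toList⁺ (boxesFrom-diagonal⁺ 0 (positive κ) i<)

row<ℓ : ∀ κ {i j} → (i , j) ∈ shape κ → i < ℓ κ
row<ℓ κ = boxesFrom-rows 0 (parts κ) ∘ VecMem.∈-toList⁻

-- The boxes of κ, as a set of places.
Within : StrictPartition → Places
Within κ (inBox p)  = p ∈ shape κ
Within κ (onEdge _) = ⊥

-- The empty set of places.
Nowhere : Places
Nowhere _ = ⊥

closed-within : ∀ κ → Closed (Within κ)
closed-within κ (left i≤j) p∈  = VecMem.∈-toList⁺ (boxesFrom-left 0 (parts κ) i≤j (VecMem.∈-toList⁻ p∈))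
closed-within κ (above _)  p∈  = VecMem.∈-toList⁺ (boxesFrom-above 0 (strict κ) z≤n (VecMem.∈-toList⁻ p∈))
closed-within κ atop       ()

-- The places of S_κ in the order of their labels.
superstandardWord : ∀ κ → Vec Place ∣ κ ∣
superstandardWord κ = Vec.map inBox (boxes κ)

⋖⇒≺ : ∀ {p q} → inBox p ⋖ inBox q → p ≺ q
⋖⇒≺ (left _)  = inj₂ (refl , ℕ.≤-refl)
⋖⇒≺ (above _) = inj₁ ℕ.≤-refl

-- Boxes in reading order form a valid word over A if they are closed under
-- predecessors up to A, as predecessors come earlier in this order.
valid-sorted : ∀ (bs : Vec Box n) → Sorted (Vec.toList bs) →
  (∀ {i j} → (i , j) Vec.∈ bs → i ≤ j) → (∀ {p} → p Vec.∈ bs → ¬ A (inBox p)) →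
  (∀ {p q} → q Vec.∈ bs → inBox p ⋖ inBox q → A (inBox p) ⊎ p Vec.∈ bs) →
  Valid A (Vec.map inBox bs)
valid-sorted [] _ _ _ _ = []
valid-sorted {A = A} (b ∷ bs) s@(b≺ ∷ s′) upper new closed = record
  { preceded = precede ; fresh = λ _ → new (here refl) ; upperTriangular = upper (here refl) }
  ∷ valid-sorted bs s′ (upper ∘ there)
      (λ { p∈ (inj₁ refl) → sorted-head s (VecMem.∈-toList⁺ p∈) ; p∈ (inj₂ Ap) → new (there p∈) Ap })
      (λ q∈ p⋖q → assoc (closed (there q∈) p⋖q))
  where
  assoc : ∀ {p} → A (inBox p) ⊎ p Vec.∈ (b ∷ bs) → (A ∙ inBox b) (inBox p) ⊎ p Vec.∈ bs
  assoc (inj₁ Ap)          = inj₁ (inj₂ Ap)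
  assoc (inj₂ (here refl)) = inj₁ (inj₁ refl)
  assoc (inj₂ (there p∈))  = inj₂ p∈
  precede : ∀ {z} → z ⋖ inBox b → A z
  precede {inBox p} p⋖b with closed (here refl) p⋖b
  ... | inj₁ Ap          = Ap
  ... | inj₂ (here refl) = contradiction (⋖⇒≺ p⋖b) (≺-asym (⋖⇒≺ p⋖b))
  ... | inj₂ (there p∈)  = contradiction (⋖⇒≺ p⋖b) (≺-asym (All.lookup b≺ (VecMem.∈-toList⁺ p∈)))

superstandard-valid : ∀ κ → Valid Nowhere (superstandardWord κ)
superstandard-valid κ = valid-sorted (boxes κ) (shape-sorted κ) (λ p∈ → shape-upper κ (VecMem.∈-toList⁺ p∈)) (λ _ ())
  (λ q∈ p⋖q → inj₂ (VecMem.∈-toList⁻ (closed-within κ p⋖q (VecMem.∈-toList⁺ q∈))))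

valid-++⁺ : ∀ {u : Vec Place m} {w : Vec Place n} →
  Valid A u → Valid (λ z → A z ⊎ z Vec.∈ u) w → Valid A (u ++ w)
valid-++⁺ []      vw = valid-resp (λ _ → [ id , (λ ()) ]′) (λ _ → inj₁) vw
valid-++⁺ (f ∷ v) vw = f ∷ valid-++⁺ v (valid-resp
  (λ _ → λ { (inj₁ Az) → inj₁ (inj₂ Az) ; (inj₂ (here z≡)) → inj₁ (inj₁ z≡) ; (inj₂ (there z∈)) → inj₂ z∈ })
  (λ _ → λ { (inj₁ (inj₂ Az)) → inj₁ Az ; (inj₁ (inj₁ z≡)) → inj₂ (here z≡) ; (inj₂ z∈) → inj₂ (there z∈) }) vw)

valid-++⁻ : ∀ {u : Vec Place m} {w : Vec Place n} →
  Valid A (u ++ w) → Valid (λ z → A z ⊎ z Vec.∈ u) w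
valid-++⁻ {u = []}    v       = valid-resp (λ _ → inj₁) (λ _ → [ id , (λ ()) ]′) v
valid-++⁻ {u = x ∷ u} (f ∷ v) = valid-resp
  (λ _ → λ { (inj₁ (inj₂ Az)) → inj₁ Az ; (inj₁ (inj₁ z≡)) → inj₂ (here z≡) ; (inj₂ z∈) → inj₂ (there z∈) })
  (λ _ → λ { (inj₁ Az) → inj₁ (inj₂ Az) ; (inj₂ (here z≡)) → inj₁ (inj₁ z≡) ; (inj₂ (there z∈)) → inj₂ z∈ })
  (valid-++⁻ {u = u} v)

∈-superstandard⁺ : ∀ κ {p} → p ∈ shape κ → inBox p Vec.∈ superstandardWord κ
∈-superstandard⁺ κ p∈ = VecMem.∈-map⁺ inBox (VecMem.∈-toList⁻ p∈)

∈-superstandard⁻ : ∀ κ {z} → z Vec.∈ superstandardWord κ → Within κ z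
∈-superstandard⁻ κ z∈ with p , p∈ , refl ← VecMem.fromAny (VecAnyP.map⁻ {f = inBox} {xs = boxes κ} z∈) =
  VecMem.∈-toList⁺ p∈

private
  within⇒ : ∀ κ z → Within κ z → Nowhere z ⊎ z Vec.∈ superstandardWord κ
  within⇒ κ (inBox _) p∈ = inj₂ (∈-superstandard⁺ κ p∈)

  within⇐ : ∀ κ z → Nowhere z ⊎ z Vec.∈ superstandardWord κ → Within κ z
  within⇐ κ _ (inj₂ z∈) = ∈-superstandard⁻ κ z∈

valid-within⇒ : ∀ κ {w : Vec Place n} → Valid (Within κ) w → Valid Nowhere (superstandardWord κ ++ w)
valid-within⇒ κ v = valid-++⁺ (superstandard-valid κ) (valid-resp (within⇒ κ) (within⇐ κ) v)

valid-within⇐ : ∀ κ {w : Vec Place n} → Valid Nowhere (superstandardWord κ ++ w) → Valid (Within κ) w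
valid-within⇐ κ v = valid-resp (within⇐ κ) (within⇒ κ) (valid-++⁻ {u = superstandardWord κ} v)

------------------------------------------------------------------------
-- Counting in vectors

module _ {A : Set} {P : A → Set} (P? : ∀ x → Dec (P x)) where

  count-witness : ∀ (xs : Vec A n) → 0 < Vec.count P? xs → ∃[ k ] P (lookup xs k)
  count-witness (x ∷ xs) 0< with P? x
  ... | yes Px = zero , Px
  ... | no _   = let k , Pk = count-witness xs 0< in suc k , Pk

  count-none : ∀ (xs : Vec A n) → (∀ k → ¬ P (lookup xs k)) → Vec.count P? xs ≡ 0
  count-none []       _    = refl
  count-none (x ∷ xs) none with P? x
  ... | yes Px = contradiction Px (none zero)
  ... | no _   = count-none xs (none ∘ suc)

  count-one : ∀ (xs : Vec A n) k → P (lookup xs k) → (∀ l → P (lookup xs l) → l ≡ k) → Vec.count P? xs ≡ 1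
  count-one (x ∷ xs) zero Pk unique with P? x
  ... | yes _  = cong suc (count-none xs (λ l Pl → Fin.0≢1+n (sym (unique (suc l) Pl))))
  ... | no ¬Px = contradiction Pk ¬Px
  count-one (x ∷ xs) (suc k) Pk unique with P? x
  ... | yes Px = contradiction (unique zero Px) Fin.0≢1+n
  ... | no _   = count-one xs k Pk (λ l Pl → Fin.suc-injective (unique (suc l) Pl))

  count-positive : ∀ (xs : Vec A n) k → P (lookup xs k) → 0 < Vec.count P? xs
  count-positive (x ∷ xs) k Pk with P? x
  count-positive (x ∷ xs) k       Pk | yes _  = s≤s z≤n
  count-positive (x ∷ xs) zero    Pk | no ¬Px = contradiction Pk ¬Px
  count-positive (x ∷ xs) (suc k) Pk | no _   = count-positive xs k Pk

  count-≤1 : ∀ (xs : Vec A n) → Vec.count P? xs ≤ 1 → ∀ {k l} → P (lookup xs k) → P (lookup xs l) → k ≡ l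
  count-≤1 (x ∷ xs) ≤1 {k} {l} Pk Pl with P? x
  count-≤1 (x ∷ xs) ≤1       {zero}  {zero}  Pk Pl | _      = refl
  count-≤1 (x ∷ xs) (s≤s ≤0) {zero}  {suc l} Pk Pl | yes _  = contradiction (count-positive xs l Pl) (ℕ.≤⇒≯ ≤0)
  count-≤1 (x ∷ xs) (s≤s ≤0) {suc k} {_}     Pk Pl | yes _  = contradiction (count-positive xs k Pk) (ℕ.≤⇒≯ ≤0)
  count-≤1 (x ∷ xs) ≤1       {zero}  {suc l} Pk Pl | no ¬Px = contradiction Pk ¬Px
  count-≤1 (x ∷ xs) ≤1       {suc k} {zero}  Pk Pl | no ¬Px = contradiction Pl ¬Px
  count-≤1 (x ∷ xs) ≤1       {suc k} {suc l} Pk Pl | no _   = cong suc (count-≤1 xs ≤1 Pk Pl)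

------------------------------------------------------------------------
-- Fillings as words

-- The box of ν/κ with the given number in reading order.
at : ∀ ν κ → Fin (length (skew ν κ)) → Box
at ν κ = List.lookup (skew ν κ)

lookup-sorted-injective : ∀ {ps} → Sorted ps → ∀ {k l} → List.lookup ps k ≡ List.lookup ps l → k ≡ l
lookup-sorted-injective {_ ∷ _} _        {zero}  {zero}  _  = refl
lookup-sorted-injective {_ ∷ _} s        {zero}  {suc l} eq =
  contradiction (subst (_∈ _) (sym eq) (∈-lookup l)) (sorted-head s)
lookup-sorted-injective {_ ∷ _} s        {suc k} {zero}  eq =
  contradiction (subst (_∈ _) eq (∈-lookup k)) (sorted-head s)
lookup-sorted-injective {_ ∷ _} (_ ∷ s)  {suc k} {suc l} eq = cong suc (lookup-sorted-injective s eq)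

module _ (ν κ : StrictPartition) where

  at-injective : ∀ {k l} → at ν κ k ≡ at ν κ l → k ≡ l
  at-injective = lookup-sorted-injective (AllPairs.filter⁺ _ (shape-sorted ν))

  at∈ν : ∀ k → at ν κ k ∈ shape ν
  at∈ν k = proj₁ (∈-filter⁻ _ {xs = shape ν} (∈-lookup k))

  at∉κ : ∀ k → at ν κ k ∉ shape κ
  at∉κ k = proj₂ (∈-filter⁻ _ {xs = shape ν} (∈-lookup k))

  at-surjective : ∀ {p} → p ∈ shape ν → p ∉ shape κ → ∃[ k ] p ≡ at ν κ k
  at-surjective p∈ν p∉κ = let p∈ = ∈-filter⁺ _ p∈ν p∉κ in ListAny.index p∈ , ListAny.lookup-index p∈

open Filling

module _ {ν κ : StrictPartition} {N : ℕ} where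

  -- The label x stands in the place z.
  Stands : Filling ν κ N → Fin N → Place → Set
  Stands F x z = (∃[ k ] lookup (labels F) k ≡ x × z ≡ inBox (at ν κ k))
               ⊎ (∃[ i ] x ∈ˢ lookup (edges F) i × z ≡ onEdge (toℕ i))

  -- C is the word of F: its x-th letter is the only place of the label x.
  record Reads (F : Filling ν κ N) (C : Vec Place N) : Set where
    field
      unique : ∀ {x z} → Stands F x z → lookup C x ≡ z
      exists : ∀ x → Stands F x (lookup C x)

  open Reads

  stands-label : ∀ F k → Stands F (lookup (labels F) k) (inBox (at ν κ k))
  stands-label F k = inj₁ (k , refl , refl)

  stands-edge : ∀ F {i x} → x ∈ˢ lookup (edges F) i → Stands F x (onEdge (toℕ i))
  stands-edge F x∈ = inj₂ (_ , x∈ , refl)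

  stands-label⁻ : ∀ F {x k} → Stands F x (inBox (at ν κ k)) → lookup (labels F) k ≡ x
  stands-label⁻ F (inj₁ (k , eq , at≡)) with refl ← at-injective ν κ (inBox-injective at≡) = eq

  stands-edge⁻ : ∀ F {x i} → Stands F x (onEdge (toℕ i)) → x ∈ˢ lookup (edges F) i
  stands-edge⁻ F (inj₂ (i , x∈ , i≡)) with refl ← Fin.toℕ-injective (onEdge-injective i≡) = x∈

  reads-injectiveˡ : ∀ {F F′ C} → Reads F C → Reads F′ C → F ≡ F′
  reads-injectiveˡ {F} {F′} r r′ = cong₂ filling
    (lookup-ext _ _ λ k → sym (stands-label⁻ F′ (move′ r r′ (stands-label F k))))
    (lookup-ext _ _ λ i → ⊆-antisym (λ x∈ → stands-edge⁻ F′ (move′ r r′ (stands-edge F x∈)))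
                             (λ x∈ → stands-edge⁻ F (move′ r′ r (stands-edge F′ x∈))))
    where
    move′ : ∀ {F F′ C x z} → Reads F C → Reads F′ C → Stands F x z → Stands F′ x z
    move′ {F′ = F′} {x = x} r r′ s = subst (Stands F′ x) (unique r s) (exists r′ x)

  reads-injectiveʳ : ∀ {F C C′} → Reads F C → Reads F C′ → C ≡ C′
  reads-injectiveʳ r r′ = lookup-ext _ _ λ x → unique r (exists r′ x)

  module _ (F : Filling ν κ N) (once : EachLabelOnce F) where

    private
      #labels #edges : Fin N → ℕ
      #labels x = Vec.count (Fin._≟ x) (labels F)
      #edges  x = Vec.count (x ∈?_) (edges F)

    stands-exists : ∀ x → ∃[ z ] Stands F x z
    stands-exists x with #labels x in eqˡ | once x
    ... | zero  | eqᵉ = let i , x∈ = count-witness (x ∈?_) (edges F) (subst (0 <_) (sym eqᵉ) (s≤s z≤n))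
                        in _ , inj₂ (i , x∈ , refl)
    ... | suc _ | _   = let k , eq = count-witness (Fin._≟ x) (labels F) (subst (0 <_) (sym eqˡ) (s≤s z≤n))
                        in _ , inj₁ (k , eq , refl)

    private
      not-both : ∀ {x} k i → lookup (labels F) k ≡ x → ¬ x ∈ˢ lookup (edges F) i
      not-both {x} k i eq x∈ = ℕ.<-irrefl (sym (once x)) (ℕ.+-mono-≤
        (count-positive (Fin._≟ x) (labels F) k eq) (count-positive (x ∈?_) (edges F) i x∈))

    stands-unique : ∀ {x z z′} → Stands F x z → Stands F x z′ → z ≡ z′
    stands-unique {x} (inj₁ (k , eq , refl)) (inj₁ (k′ , eq′ , refl)) = cong (inBox ∘ at ν κ)
      (count-≤1 (Fin._≟ x) (labels F) (ℕ.≤-trans (ℕ.m≤m+n _ _) (ℕ.≤-reflexive (once x))) eq eq′)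
    stands-unique {x} (inj₂ (i , x∈ , refl)) (inj₂ (i′ , x∈′ , refl)) = cong (onEdge ∘ toℕ)
      (count-≤1 (x ∈?_) (edges F) (ℕ.≤-trans (ℕ.m≤n+m _ (#labels x)) (ℕ.≤-reflexive (once x))) x∈ x∈′)
    stands-unique (inj₁ (k , eq , _)) (inj₂ (i , x∈ , _)) = ⊥-elim (not-both k i eq x∈)
    stands-unique (inj₂ (i , x∈ , _)) (inj₁ (k , eq , _)) = ⊥-elim (not-both k i eq x∈)

    -- The word of a filling with each label once.
    reading : Vec Place N
    reading = Vec.tabulate (λ x → proj₁ (stands-exists x))

    reads-reading : Reads F reading
    reads-reading = record
      { unique = λ {x} s → stands-unique (ex x) s
      ; exists = ex }
      where
      ex : ∀ x → Stands F x (lookup reading x)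
      ex x = subst (Stands F x) (sym (Vec.lookup∘tabulate _ x)) (proj₂ (stands-exists x))

-- Validity in terms of the positions of the letters.
valid-tabulate : ∀ (C : Vec Place n) →
  (∀ x {z} → z ⋖ lookup C x → A z ⊎ ∃[ y ] y Fin.< x × lookup C y ≡ z) →
  (∀ x → IsBox (lookup C x) → ¬ A (lookup C x)) →
  (∀ {x y} → IsBox (lookup C x) → lookup C y ≡ lookup C x → y ≡ x) →
  (∀ x → UpperTriangular (lookup C x)) → Valid A C
valid-tabulate []      _ _ _ _ = []
valid-tabulate {n = suc n} {A = A} (c ∷ C) pre new inj upper = record
  { preceded = λ z⋖ → head-pre (pre zero z⋖) ; fresh = new zero ; upperTriangular = upper zero }
  ∷ valid-tabulate C (λ x z⋖ → tail-pre (pre (suc x) z⋖))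
      (λ x b → λ { (inj₁ eq) → Fin.0≢1+n (inj {suc x} {zero} b (sym eq)) ; (inj₂ Az) → new (suc x) b Az })
      (λ {x} {y} b eq → Fin.suc-injective (inj {suc x} {suc y} b eq)) (upper ∘ suc)
  where
  head-pre : ∀ {z} → A z ⊎ (∃[ y ] y Fin.< zero {n} × lookup (c ∷ C) y ≡ z) → A z
  head-pre (inj₁ Az) = Az
  tail-pre : ∀ {x z} → A z ⊎ (∃[ y ] y Fin.< suc x × lookup (c ∷ C) y ≡ z) →
    (A ∙ c) z ⊎ (∃[ y ] y Fin.< x × lookup C y ≡ z)
  tail-pre (inj₁ Az)                    = inj₁ (inj₂ Az)
  tail-pre (inj₂ (zero  , _ , eq))      = inj₁ (inj₁ (sym eq))
  tail-pre (inj₂ (suc y , s≤s y<x , eq)) = inj₂ (y , y<x , eq)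

valid-preceded : ∀ {C : Vec Place n} → Valid A C → ∀ x {z} → z ⋖ lookup C x → A z ⊎ ∃[ y ] y Fin.< x × lookup C y ≡ z
valid-preceded (f ∷ _) zero    z⋖ = inj₁ (preceded f z⋖)
valid-preceded (_ ∷ v) (suc x) z⋖ with valid-preceded v x z⋖
... | inj₁ (inj₁ refl)      = inj₂ (zero , s≤s z≤n , refl)
... | inj₁ (inj₂ Az)        = inj₁ Az
... | inj₂ (y , y<x , eq)   = inj₂ (suc y , s≤s y<x , eq)

valid-injective : ∀ {C : Vec Place n} → Valid A C → ∀ {x y} → IsBox (lookup C x) → lookup C y ≡ lookup C x → y ≡ x
valid-injective (_ ∷ v) {zero}  {zero}  b eq = refl
valid-injective (f ∷ v) {zero}  {suc y} b eq = contradiction eq (valid-fresh v b (inj₁ refl) y)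
valid-injective (f ∷ v) {suc x} {zero}  b eq = contradiction (sym eq) (valid-fresh v (subst IsBox (sym eq) b) (inj₁ refl) x)
valid-injective (_ ∷ v) {suc x} {suc y} b eq = cong suc (valid-injective v b eq)

open Reads

module _ {ν κ : StrictPartition} {N : ℕ} {F : Filling ν κ N} {C : Vec Place N} (r : Reads F C) where

  -- Row, column and edge conditions between neighbouring places say that
  -- every letter comes after the places it needs.
  reads-valid : IsTableau F → Valid (Within κ) C
  reads-valid (_ , rows , columns , edgesIncrease) = valid-tabulate C
    (λ x z⋖ → pre (exists r x) z⋖)
    (λ x b Ax → new (exists r x) Ax)
    (λ {x} {y} b eq → injective b (exists r x) eq)
    (λ x → upper (exists r x))
    where
    less : ∀ {l k p q} → inBox p ⋖ inBox q → p ≡ at ν κ l → q ≡ at ν κ k →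
      lookup (labels F) l Fin.< lookup (labels F) k
    less {l} {k} (left _) p≡ q≡ = rows l k (trans (sym (cong row p≡)) (cong row q≡))
      (subst₂ _<_ (cong col p≡) (cong col q≡) ℕ.≤-refl)
    less {l} {k} (above _) p≡ q≡ = columns l k (trans (sym (cong col p≡)) (cong col q≡))
      (subst₂ _<_ (cong row p≡) (cong row q≡) ℕ.≤-refl)

    earlier : ∀ {x p} → p ∈ shape ν → (∀ {l} → p ≡ at ν κ l → lookup (labels F) l Fin.< x) →
      Within κ (inBox p) ⊎ (∃[ y ] y Fin.< x × lookup C y ≡ inBox p)
    earlier {p = p} p∈ν l< with p ∈ᴮ? shape κ
    ... | yes p∈κ = inj₁ p∈κ
    ... | no p∉κ with l , refl ← at-surjective ν κ p∈ν p∉κ = inj₂ (_ , l< refl , unique r (stands-label F l))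

    pre : ∀ {x z y} → Stands F x y → z ⋖ y → Within κ z ⊎ (∃[ y ] y Fin.< x × lookup C y ≡ z)
    pre (inj₁ (k , refl , eq)) (left i≤j) = earlier
      (closed-within ν (left i≤j) (subst (_∈ shape ν) (sym (inBox-injective eq)) (at∈ν ν κ k)))
      (λ p≡ → less (left i≤j) p≡ (inBox-injective eq))
    pre (inj₁ (k , refl , eq)) (above i<j) = earlier
      (closed-within ν (above i<j) (subst (_∈ shape ν) (sym (inBox-injective eq)) (at∈ν ν κ k)))
      (λ p≡ → less (above i<j) p≡ (inBox-injective eq))
    pre (inj₂ (i , x∈ , refl)) atop = earlier (diagonal∈shape ν (Fin.toℕ<n i))
      (λ {l} p≡ → edgesIncrease i l _ (sym (cong col p≡)) x∈)

    new : ∀ {x z} → Stands F x z → ¬ Within κ z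
    new (inj₁ (k , _ , refl)) = at∉κ ν κ k
    new (inj₂ (_ , _ , refl)) = id

    injective : ∀ {x y z} → IsBox z → Stands F x z → lookup C y ≡ z → y ≡ x
    injective {y = y} b (inj₁ (k , refl , refl)) eq =
      sym (stands-label⁻ F (subst (Stands F y) eq (exists r y)))
    injective b (inj₂ (_ , _ , refl)) _ = ⊥-elim b

    upper : ∀ {x z} → Stands F x z → UpperTriangular z
    upper (inj₁ (k , _ , refl)) = shape-upper ν (at∈ν ν κ k)
    upper (inj₂ (_ , _ , refl)) = tt

  reads-outer : κ ⊆ ν → Outer Nowhere (superstandardWord κ ++ C) (shape ν)
  reads-outer κ⊆ν = record
    { sorted = shape-sorted ν
    ; complete = λ { (inj₂ z∈) → [ (λ z∈κ → κ⊆ν (∈-superstandard⁻ κ z∈κ)) , in-ν ]′ (VecAnyP.++⁻ (superstandardWord κ) z∈) }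
    ; sound = λ q∈ → inj₂ (occupied q∈) }
    where
    in-ν : ∀ {q} → inBox q Vec.∈ C → q ∈ shape ν
    in-ν {q} q∈ with exists r (VecAny.index q∈)
    ... | inj₁ (k , _ , eq) = subst (_∈ shape ν) (sym (inBox-injective (trans (VecAnyP.lookup-index q∈) eq))) (at∈ν ν κ k)
    ... | inj₂ (_ , _ , eq) = contradiction (trans (VecAnyP.lookup-index q∈) eq) inBox≢onEdge
    occupied : ∀ {q} → q ∈ shape ν → inBox q Vec.∈ (superstandardWord κ ++ C)
    occupied {q} q∈ν with q ∈ᴮ? shape κ
    ... | yes q∈κ = VecMem.∈-++⁺ˡ (∈-superstandard⁺ κ q∈κ)
    ... | no q∉κ with k , refl ← at-surjective ν κ q∈ν q∉κ = VecMem.∈-++⁺ʳ (superstandardWord κ)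
      (subst (Vec._∈ C) (unique r (stands-label F k)) (VecMem.∈-lookup _ C))

labelIn-lookup : ∀ {k} (ps : Vec Box k) (xs : Vec (Fin N) k) → (∀ {i j} → lookup ps i ≡ lookup ps j → i ≡ j) →
  ∀ i → labelIn ps xs (lookup ps i) ≡ just (lookup xs i)
labelIn-lookup ps xs inj i with lookup ps i ∈ᵛ? ps
... | yes p∈ = cong (just ∘ lookup xs) (inj (sym (VecAnyP.lookup-index p∈)))
... | no p∉  = contradiction (VecMem.∈-lookup i ps) p∉

labelIn-just : ∀ {k} (ps : Vec Box k) (xs : Vec (Fin N) k) {p x} → labelIn ps xs p ≡ just x →
  ∃[ i ] p ≡ lookup ps i × lookup xs i ≡ x
labelIn-just ps xs {p} eq with p ∈ᵛ? ps
... | yes p∈ = VecAny.index p∈ , VecAnyP.lookup-index p∈ , Maybe.just-injective eq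

∈-edgeIn⁻ : ∀ {k} (es : Vec (Subset N) k) {i x} → x ∈ˢ edgeIn es i → ∃[ j ] x ∈ˢ lookup es j × i ≡ toℕ j
∈-edgeIn⁻ {k = k} es {i} x∈ with i ℕ.<? k
... | yes i<k = Fin.fromℕ< i<k , x∈ , sym (Fin.toℕ-fromℕ< i<k)
... | no _    = contradiction x∈ ∉⊥

∈-edgeIn⁺ : ∀ {k} (es : Vec (Subset N) k) {j x} → x ∈ˢ lookup es j → x ∈ˢ edgeIn es (toℕ j)
∈-edgeIn⁺ {k = k} es {j} {x} x∈ with toℕ j ℕ.<? k
... | yes j<k = subst (λ j → x ∈ˢ lookup es j) (sym (Fin.fromℕ<-toℕ j j<k)) x∈
... | no j≮k  = contradiction (Fin.toℕ<n j) j≮k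

lookup-fromList : ∀ {A : Set} (xs : List A) k → lookup (Vec.fromList xs) k ≡ List.lookup xs k
lookup-fromList (x ∷ xs) zero    = refl
lookup-fromList (x ∷ xs) (suc k) = lookup-fromList xs k

reads-represents : ∀ {ν κ} {F : Filling ν κ N} {C} → Reads F C → Represents (toTableau F) C
reads-represents {ν = ν} {κ} {F} {C} r = record
  { box⇒ = λ eq → let k , p≡ , x≡ = labelIn-just ps (labels F) eq in
      unique r (inj₁ (k , x≡ , cong inBox (trans p≡ (lookup-fromList (skew ν κ) k))))
  ; box⇐ = λ {q} {x} eq → from (exists r x) eq
  ; edge⇒ = λ x∈ → let j , x∈′ , i≡ = ∈-edgeIn⁻ (edges F) x∈ in unique r (inj₂ (j , x∈′ , cong onEdge i≡))
  ; edge⇐ = λ {i} {x} eq → edge-from (exists r x) eq }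
  where
  ps = Vec.fromList (skew ν κ)
  inj : ∀ {i j} → lookup ps i ≡ lookup ps j → i ≡ j
  inj {i} {j} eq = at-injective ν κ (trans (sym (lookup-fromList (skew ν κ) i)) (trans eq (lookup-fromList (skew ν κ) j)))
  from : ∀ {x z q} → Stands F x z → z ≡ inBox q → labelIn ps (labels F) q ≡ just x
  from (inj₁ (k , refl , refl)) refl = trans (cong (labelIn ps (labels F)) (sym (lookup-fromList (skew ν κ) k)))
    (labelIn-lookup ps (labels F) inj k)
  from (inj₂ (_ , _ , refl)) ()
  edge-from : ∀ {x z i} → Stands F x z → z ≡ onEdge i → x ∈ˢ edgeIn (edges F) i
  edge-from (inj₁ (_ , _ , refl)) ()
  edge-from (inj₂ (j , x∈ , refl)) refl = ∈-edgeIn⁺ (edges F) x∈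

pass-∈-++ : ∀ {u u′ z} {ts ts′ : Vec Place n} {us : Vec Place m} → Pass u ts ts′ u′ →
  z Vec.∈ (u ∷ ts) → z Vec.∈ (ts′ ++ u′ ∷ us)
pass-∈-++ {ts′ = ts′} p z∈ = [ (λ { refl → VecMem.∈-++⁺ʳ ts′ (here refl) }) , VecMem.∈-++⁺ˡ ]′ (pass-∈⁺ p z∈)

infusion-∈ : ∀ {us us′ : Vec Place m} {ts ts′ : Vec Place n} {z} → Infusion us ts ts′ us′ →
  z Vec.∈ (us ++ ts) → z Vec.∈ (ts′ ++ us′)
infusion-∈ []      z∈          = VecMem.∈-++⁺ˡ z∈
infusion-∈ (p ∷ i) (here refl) = pass-∈-++ p (here refl)
infusion-∈ {ts′ = ts′} (_∷_ {ts₁ = ts₁} p i) (there z∈) with VecAnyP.++⁻ ts₁ (infusion-∈ i z∈)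
... | inj₁ z∈ts = pass-∈-++ p (there z∈ts)
... | inj₂ z∈us = VecMem.∈-++⁺ʳ ts′ (there z∈us)

outer-infusion : ∀ {us us′ : Vec Place m} {ts ts′ : Vec Place n} {ps} → Infusion us ts ts′ us′ →
  Outer A (us ++ ts) ps → Outer A (ts′ ++ us′) ps
outer-infusion i o = record
  { sorted = sorted o
  ; complete = λ z∈ → complete o (Sum.map₂ (infusion-∈ (infusion-sym i)) z∈)
  ; sound = λ q∈ → Sum.map₂ (infusion-∈ i) (sound o q∈) }

------------------------------------------------------------------------
-- The filling of a valid word

-- A closed set contains, with a box, the boxes to its left in the same
-- row, up to the diagonal.
closed-row : Closed A → ∀ {i j} j′ → j ≤ j′ → i ≤ j → A (inBox (i , j′)) → A (inBox (i , j))
closed-row cl {j = j} j′ j≤j′ i≤j Aq with j ℕ.≟ j′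
... | yes refl = Aq
closed-row cl zero j≤0 i≤j Aq | no j≢0 = contradiction (ℕ.n≤0⇒n≡0 j≤0) j≢0
closed-row cl (suc j′) j≤ i≤j Aq | no j≢ =
  closed-row cl j′ j≤j′ i≤j (cl (left (ℕ.≤-trans i≤j j≤j′)) Aq)
  where j≤j′ = ℕ.s≤s⁻¹ (ℕ.≤∧≢⇒< j≤ j≢)

-- Likewise for the boxes above in the same column.
closed-column : Closed A → ∀ {i j} i′ → i ≤ i′ → i′ ≤ j → A (inBox (i′ , j)) → A (inBox (i , j))
closed-column cl {i = i} i′ i≤i′ i′≤j Aq with i ℕ.≟ i′
... | yes refl = Aq
closed-column cl zero i≤0 _ Aq | no i≢0 = contradiction (ℕ.n≤0⇒n≡0 i≤0) i≢0
closed-column cl (suc i′) i≤ i′<j Aq | no i≢ =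
  closed-column cl i′ (ℕ.s≤s⁻¹ (ℕ.≤∧≢⇒< i≤ i≢)) (ℕ.<⇒≤ i′<j) (cl (above i′<j) Aq)

module _ (ν μ : StrictPartition) {N : ℕ} {C : Vec Place N} (v : Valid (Within μ) C)
         (o : Outer Nowhere (superstandardWord μ ++ C) (shape ν)) where

  outer⇒⊆ : μ ⊆ ν
  outer⇒⊆ p∈μ = complete o (inj₂ (VecMem.∈-++⁺ˡ (∈-superstandard⁺ μ p∈μ)))

  private
    in-ν : ∀ {x q} → lookup C x ≡ inBox q → q ∈ shape ν
    in-ν {x} eq = complete o (inj₂ (VecMem.∈-++⁺ʳ (superstandardWord μ) (subst (Vec._∈ C) eq (VecMem.∈-lookup x C))))

    labelAt : ∀ k → ∃[ x ] lookup C x ≡ inBox (at ν μ k)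
    labelAt k with sound o (at∈ν ν μ k)
    ... | inj₂ q∈ with VecAnyP.++⁻ (superstandardWord μ) q∈
    ...   | inj₁ q∈μ = contradiction (∈-superstandard⁻ μ q∈μ) (at∉κ ν μ k)
    ...   | inj₂ q∈C = VecAny.index q∈C , sym (VecAnyP.lookup-index q∈C)

    isOnEdge? : ∀ z i → Dec (z ≡ onEdge i)
    isOnEdge? (inBox _)  i = no λ ()
    isOnEdge? (onEdge j) i = map′ (cong onEdge) onEdge-injective (j ℕ.≟ i)

    edgeSet : ∀ i → Subset N
    edgeSet i = Vec.tabulate (λ x → does (isOnEdge? (lookup C x) i))

    ∈-edgeSet⁺ : ∀ {i x} → lookup C x ≡ onEdge i → x ∈ˢ edgeSet i
    ∈-edgeSet⁺ {i} {x} eq = Vec.lookup⇒[]= x _ (trans (Vec.lookup∘tabulate _ x) (dec-true (isOnEdge? _ i) eq))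

    ∈-edgeSet⁻ : ∀ {i x} → x ∈ˢ edgeSet i → lookup C x ≡ onEdge i
    ∈-edgeSet⁻ {i} {x} x∈ with isOnEdge? (lookup C x) i | trans (sym (Vec.lookup∘tabulate (λ x → does (isOnEdge? (lookup C x) i)) x)) (Vec.[]=⇒lookup x∈)
    ... | yes eq | _ = eq

  -- The label x is put into the x-th letter of C.
  fillingOf : Filling ν μ N
  fillingOf = filling (Vec.tabulate (λ k → proj₁ (labelAt k))) (Vec.tabulate (λ i → edgeSet (toℕ i)))

  private
    F = fillingOf

    label⇒ : ∀ {k x} → lookup (labels F) k ≡ x → lookup C x ≡ inBox (at ν μ k)
    label⇒ {k} refl = trans (cong (lookup C) (Vec.lookup∘tabulate (λ k → proj₁ (labelAt k)) k)) (proj₂ (labelAt k))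

    label⇐ : ∀ {k x} → lookup C x ≡ inBox (at ν μ k) → lookup (labels F) k ≡ x
    label⇐ {k} {x} eq = valid-injective v (subst IsBox (sym eq) tt) (trans (label⇒ {k} refl) (sym eq))

    edge⇒′ : ∀ {i x} → x ∈ˢ lookup (edges F) i → lookup C x ≡ onEdge (toℕ i)
    edge⇒′ {i} {x} x∈ = ∈-edgeSet⁻ (subst (x ∈ˢ_) (Vec.lookup∘tabulate (λ i → edgeSet (toℕ i)) i) x∈)

    edge⇐′ : ∀ {i x} → lookup C x ≡ onEdge (toℕ i) → x ∈ˢ lookup (edges F) i
    edge⇐′ {i} {x} eq = subst (x ∈ˢ_) (sym (Vec.lookup∘tabulate (λ i → edgeSet (toℕ i)) i)) (∈-edgeSet⁺ eq)

    -- The places occupied before the label x.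
    Before : Fin N → Places
    Before x z = Within μ z ⊎ (∃[ y ] y Fin.< x × lookup C y ≡ z)

    before-closed : ∀ x → Closed (Before x)
    before-closed x z⋖ (inj₁ z∈) = inj₁ (closed-within μ z⋖ z∈)
    before-closed x z⋖ (inj₂ (y , y<x , refl)) with valid-preceded v y z⋖
    ... | inj₁ z∈                 = inj₁ z∈
    ... | inj₂ (y′ , y′<y , eq) = inj₂ (y′ , Fin.<-trans y′<y y<x , eq)

    before-⋖ : ∀ {x z z′} → lookup C x ≡ z′ → z ⋖ z′ → Before x z
    before-⋖ {x} refl z⋖ = valid-preceded v x z⋖

    before-label : ∀ {l x q} → Before x (inBox q) → q ≡ at ν μ l → lookup (labels F) l Fin.< x
    before-label {l} (inj₁ q∈μ)             refl = contradiction q∈μ (at∉κ ν μ l)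
    before-label     (inj₂ (y , y<x , eq))  refl = subst (Fin._< _) (sym (label⇐ eq)) y<x

    edge<ℓ : ∀ {i} x → lookup C x ≡ onEdge i → i < ℓ ν
    edge<ℓ x eq with before-⋖ eq atop
    ... | inj₁ q∈μ          = row<ℓ ν (outer⇒⊆ q∈μ)
    ... | inj₂ (y , _ , eq) = row<ℓ ν (in-ν eq)

  fillingOf-reads : Reads fillingOf C
  fillingOf-reads = record
    { unique = λ { (inj₁ (k , eq , refl)) → label⇒ eq ; (inj₂ (i , x∈ , refl)) → edge⇒′ x∈ }
    ; exists = λ x → stands x refl }
    where
    stands : ∀ x {z} → lookup C x ≡ z → Stands fillingOf x z
    stands x {inBox q} eq with k , refl ← at-surjective ν μ (in-ν eq) (λ q∈μ → valid-fresh v tt q∈μ x eq) = inj₁ (k , label⇐ eq , refl)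
    stands x {onEdge i} eq = inj₂ (Fin.fromℕ< i<ℓ , edge⇐′ (trans eq i≡) , i≡)
      where
      i<ℓ = edge<ℓ x eq
      i≡ = cong onEdge (sym (Fin.toℕ-fromℕ< i<ℓ))

  -- The labels increase along rows and columns, not only between
  -- neighbours, because the places occupied before a label form a closed
  -- set.
  fillingOf-tableau : IsTableau fillingOf
  fillingOf-tableau = once , rows , columns , edgesIncrease
    where
    once : EachLabelOnce F
    once x with exists fillingOf-reads x
    ... | inj₁ (k , eq , z≡) = cong₂ ℕ._+_
      (count-one (Fin._≟ x) (labels F) k eq
        (λ l eq′ → at-injective ν μ (inBox-injective (trans (sym (label⇒ eq′)) z≡))))
      (count-none (x ∈?_) (edges F) (λ i x∈ → inBox≢onEdge (trans (sym z≡) (edge⇒′ x∈))))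
    ... | inj₂ (i , x∈ , z≡) = cong₂ ℕ._+_
      (count-none (Fin._≟ x) (labels F) (λ k eq → inBox≢onEdge (trans (sym (label⇒ eq)) z≡)))
      (count-one (x ∈?_) (edges F) i x∈
        (λ j x∈′ → Fin.toℕ-injective (onEdge-injective (trans (sym (edge⇒′ x∈′)) z≡))))

    rows : RowsIncrease F
    rows k l r≡ c< = row-less (label⇒ refl) refl r≡ c< (shape-upper ν (at∈ν ν μ k))
      where
      row-less : ∀ {x p q} → lookup C x ≡ inBox q → p ≡ at ν μ k → row p ≡ row q → col p < col q →
        row p ≤ col p → lookup (labels F) k Fin.< x
      row-less {x} {i , j} {_ , suc j′} Cx p≡ refl (s≤s j≤j′) i≤j = before-label
        (closed-row (before-closed x) j′ j≤j′ i≤j (before-⋖ Cx (left (ℕ.≤-trans i≤j j≤j′)))) p≡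

    columns : ColumnsIncrease F
    columns k l c≡ r< = column-less (label⇒ refl) refl c≡ r< (shape-upper ν (at∈ν ν μ l))
      where
      column-less : ∀ {x p q} → lookup C x ≡ inBox q → p ≡ at ν μ k → col p ≡ col q → row p < row q →
        row q ≤ col q → lookup (labels F) k Fin.< x
      column-less {x} {i , j} {suc i′ , _} Cx p≡ refl (s≤s i≤i′) i′<j = before-label
        (closed-column (before-closed x) i′ i≤i′ (ℕ.<⇒≤ i′<j) (before-⋖ Cx (above i′<j))) p≡

    edgesIncrease : EdgesIncrease F
    edgesIncrease i k x c≡ x∈ = before-label
      (closed-column (before-closed x) (toℕ i) (subst (row (at ν μ k) ≤_) c≡ (shape-upper ν (at∈ν ν μ k))) ℕ.≤-refl
        (before-⋖ (edge⇒′ x∈) atop))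
      (cong (row (at ν μ k) ,_) (sym c≡))

------------------------------------------------------------------------
-- Rectifying to the superstandard tableau

lookup-boxes-injective : ∀ μ {i j} → lookup (boxes μ) i ≡ lookup (boxes μ) j → i ≡ j
lookup-boxes-injective μ = injective (boxes μ) (shape-sorted μ)
  where
  injective : ∀ {n} (bs : Vec Box n) → Sorted (Vec.toList bs) → ∀ {i j} → lookup bs i ≡ lookup bs j → i ≡ j
  injective (_ ∷ _)  _       {zero}  {zero}  _    = refl
  injective (_ ∷ bs) s       {zero}  {suc j} refl = contradiction (VecMem.∈-toList⁺ (VecMem.∈-lookup j bs)) (sorted-head s)
  injective (_ ∷ bs) s       {suc i} {zero}  refl = contradiction (VecMem.∈-toList⁺ (VecMem.∈-lookup i bs)) (sorted-head s)
  injective (_ ∷ bs) (_ ∷ s) {suc i} {suc j} eq   = cong suc (injective bs s eq)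

superstandard-box : ∀ μ i → box (superstandard μ) (lookup (boxes μ) i) ≡ just i
superstandard-box μ i = trans (labelIn-lookup (boxes μ) (Vec.allFin ∣ μ ∣) (lookup-boxes-injective μ) i)
  (cong just (Vec.lookup-allFin i))

module _ (μ : StrictPartition) {T : Tableau ∣ μ ∣} {C : Vec Place ∣ μ ∣} (rect : Rectified Nowhere [] C T) where

  private
    lookup-word : ∀ i → lookup (superstandardWord μ) i ≡ inBox (lookup (boxes μ) i)
    lookup-word i = Vec.lookup-map i inBox (boxes μ)

  ≐⇒superstandardWord : T ≐ superstandard μ → C ≡ superstandardWord μ
  ≐⇒superstandardWord (_ , _ , agree) = lookup-ext _ _ λ i → trans
    (box⇒ (represented rect) (trans
      (proj₁ (All.lookup agree (VecMem.∈-toList⁺ (VecMem.∈-lookup i (boxes μ)))))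
      (superstandard-box μ i)))
    (sym (lookup-word i))

  superstandardWord⇒≐ : C ≡ superstandardWord μ → T ≐ superstandard μ
  superstandardWord⇒≐ refl =
      sorted-≡ (sorted (outer-boxes rect)) (shape-sorted μ)
        (λ p p∈ → [ (λ ()) , ∈-superstandard⁻ μ ]′ (sound (outer-boxes rect) p∈))
        (λ p p∈ → complete (outer-boxes rect) (inj₂ (∈-superstandard⁺ μ p∈)))
    , inner-pre rect
    , All.tabulate (λ p∈ → same-box (VecMem.∈-toList⁻ p∈)
        , Empty-unique (λ { (x , x∈) → inBox≢onEdge (trans (sym (lookup-word x)) (edge⇒ (represented rect) x∈)) }))
    where
    same-box : ∀ {p} → p Vec.∈ boxes μ → box T p ≡ box (superstandard μ) p
    same-box p∈ = subst (λ p → box T p ≡ box (superstandard μ) p) (sym (VecAnyP.lookup-index p∈))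
      (trans (box⇐ (represented rect) (lookup-word (VecAny.index p∈))) (sym (superstandard-box μ (VecAny.index p∈))))

reads-rectified : ∀ {ν κ} {F : Filling ν κ N} {C C′ us′} → κ ⊆ ν → Valid (Within κ) C → Reads F C →
  Infusion (superstandardWord κ) C C′ us′ → Rectified Nowhere [] C′ (shEqRect F)
reads-rectified {κ = κ} κ⊆ν v r inf = rectify-correct [] (boxes κ) (shape-sorted κ) refl (λ _ ())
  (valid-within⇒ κ v) inf (reads-represents r) (reads-outer r κ⊆ν)

------------------------------------------------------------------------
-- Transposition of tableaux

-- The tableaux counted by d κ μ ν, for κ ⊆ ν.
rectifying : ∀ κ μ ν → List (Filling ν κ ∣ μ ∣)
rectifying κ μ ν = filter (λ T → shEqRect T ≐? superstandard μ) (eqShSYT ν κ ∣ μ ∣)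

-- The infusion of S_κ and F results in S_μ and F′.
Transposed : ∀ {κ μ ν} → Filling ν κ ∣ μ ∣ → Filling ν μ ∣ κ ∣ → Set
Transposed {κ} {μ} F F′ = ∃[ C ] ∃[ C′ ] Reads F C × Reads F′ C′ ×
  Infusion (superstandardWord κ) C (superstandardWord μ) C′

-- F can be recovered from F′ since infusion is an involution.
transposed-injective : ∀ {κ μ ν} {F₁ F₂ : Filling ν κ ∣ μ ∣} {F′ : Filling ν μ ∣ κ ∣} →
  Transposed F₁ F′ → Transposed F₂ F′ → F₁ ≡ F₂
transposed-injective (_ , _ , r₁ , r₁′ , inf₁) (_ , _ , r₂ , r₂′ , inf₂)
  with refl ← reads-injectiveʳ r₁′ r₂′
  with refl ← proj₂ (infusion-functional (infusion-sym inf₁) (infusion-sym inf₂)) = reads-injectiveˡ r₁ r₂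

vectors-complete : ∀ {A : Set} {xs : List A} → (∀ x → x ∈ xs) → ∀ {k} (v : Vec A k) → v ∈ vectors xs k
vectors-complete all []      = here refl
vectors-complete all (x ∷ v) = ∈-cartesianProductWith⁺ _∷_ (all x) (vectors-complete all v)

vectors-unique : ∀ {A : Set} {xs : List A} → Unique xs → ∀ k → Unique (vectors xs k)
vectors-unique u zero    = [] ∷ []
vectors-unique u (suc k) = Unique.cartesianProductWith⁺ _∷_ (λ { refl → refl , refl }) u (vectors-unique u k)

fillings-complete : ∀ {ν κ} (F : Filling ν κ N) → F ∈ fillings ν κ N
fillings-complete (filling ls es) = ∈-cartesianProductWith⁺ filling
  (vectors-complete ∈-allFin ls)
  (vectors-complete (vectors-complete (λ { inside → here refl ; outside → there (here refl) })) es)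

fillings-unique : ∀ ν κ N → Unique (fillings ν κ N)
fillings-unique ν κ N = Unique.cartesianProductWith⁺ filling (λ { refl → refl , refl })
  (vectors-unique (Unique.allFin⁺ N) _)
  (vectors-unique (vectors-unique (((λ ()) ∷ []) ∷ [] ∷ []) N) _)

rectifying-unique : ∀ κ μ ν → Unique (rectifying κ μ ν)
rectifying-unique κ μ ν = Unique.filter⁺ (λ T → shEqRect T ≐? superstandard μ) {xs = eqShSYT ν κ ∣ μ ∣}
  (Unique.filter⁺ isTableau? {xs = fillings ν κ ∣ μ ∣} (fillings-unique ν κ ∣ μ ∣))

∈-rectifying⁺ : ∀ κ μ ν {F} → IsTableau F → shEqRect F ≐ superstandard μ → F ∈ rectifying κ μ ν
∈-rectifying⁺ κ μ ν {F} tab rect = ∈-filter⁺ (λ T → shEqRect T ≐? superstandard μ) {xs = eqShSYT ν κ ∣ μ ∣}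
  (∈-filter⁺ isTableau? {xs = fillings ν κ ∣ μ ∣} (fillings-complete F) tab) rect

∈-rectifying⁻ : ∀ κ μ ν {F} → F ∈ rectifying κ μ ν → IsTableau F × shEqRect F ≐ superstandard μ
∈-rectifying⁻ κ μ ν {F} F∈ =
  let F∈eq , rect = ∈-filter⁻ (λ T → shEqRect T ≐? superstandard μ) {xs = eqShSYT ν κ ∣ μ ∣} F∈
  in proj₂ (∈-filter⁻ isTableau? {xs = fillings ν κ ∣ μ ∣} F∈eq) , rect

-- Each F counted by d κ μ ν has a counterpart F′ counted by d μ κ ν; in
-- particular, μ ⊆ ν as soon as there is such an F.
transpose : ∀ {κ μ ν} → κ ⊆ ν → ∀ {F} → F ∈ rectifying κ μ ν →
  μ ⊆ ν × ∃[ F′ ] F′ ∈ rectifying μ κ ν × Transposed F F′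
transpose {κ} {μ} {ν} κ⊆ν {F} F∈ = outer⇒⊆ ν μ v′ o′ , F′ , F′∈ , C , C′ , reads , fillingOf-reads ν μ v′ o′ , inf
  where
  tab : IsTableau F
  tab = proj₁ (∈-rectifying⁻ κ μ ν F∈)
  rect : shEqRect F ≐ superstandard μ
  rect = proj₂ (∈-rectifying⁻ κ μ ν F∈)
  C : Vec Place ∣ μ ∣
  C = reading F (proj₁ tab)
  reads : Reads F C
  reads = reads-reading F (proj₁ tab)
  v : Valid (Within κ) C
  v = reads-valid reads tab
  total = infusion-total (superstandardWord κ) C
  C′    = proj₁ (proj₂ total)
  inf : Infusion (superstandardWord κ) C (superstandardWord μ) C′
  inf = subst (λ w → Infusion (superstandardWord κ) C w C′)
    (≐⇒superstandardWord μ (reads-rectified κ⊆ν v reads (proj₂ (proj₂ total))) rect) (proj₂ (proj₂ total))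
  v′ : Valid (Within μ) C′
  v′ = valid-within⇐ μ (infusion-valid inf (valid-within⇒ κ v))
  o′ : Outer Nowhere (superstandardWord μ ++ C′) (shape ν)
  o′ = outer-infusion inf (reads-outer reads κ⊆ν)
  F′ : Filling ν μ ∣ κ ∣
  F′ = fillingOf ν μ v′ o′
  F′∈ : F′ ∈ rectifying μ κ ν
  F′∈ = ∈-rectifying⁺ μ κ ν (fillingOf-tableau ν μ v′ o′)
    (superstandardWord⇒≐ κ (reads-rectified (outer⇒⊆ ν μ v′ o′) v′ (fillingOf-reads ν μ v′ o′) (infusion-sym inf)) refl)

-- The pigeonhole principle, for an injection that is given as a relation.
length-≤ : ∀ {A B : Set} {R : A → B → Set} {xs : List A} {ys : List B} → Unique xs →
  (∀ {x} → x ∈ xs → ∃[ y ] y ∈ ys × R x y) → (∀ {x x′ y} → R x y → R x′ y → x ≡ x′) →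
  length xs ≤ length ys
length-≤ [] _ _ = z≤n
length-≤ {R = R} {xs = x ∷ xs} (x∉ ∷ u) image injective
  with y , y∈ , Rxy ← image (here refl)
  with as , bs , refl ← ∈-∃++ y∈ = subst (suc (length xs) ≤_)
    (sym (trans (List.length-++ as) (trans (ℕ.+-suc (length as) (length bs)) (cong suc (sym (List.length-++ as))))))
    (s≤s (length-≤ {R = R} u image′ injective))
  where
  image′ : ∀ {x′} → x′ ∈ xs → ∃[ y′ ] y′ ∈ as List.++ bs × R x′ y′
  image′ x′∈ with y′ , y′∈ , Rx′y′ ← image (there x′∈) with ∈-++⁻ as y′∈
  ... | inj₁ y′∈as         = y′ , ∈-++⁺ˡ y′∈as , Rx′y′
  ... | inj₂ (here refl)   = contradiction (injective Rxy Rx′y′) (All.lookup x∉ x′∈)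
  ... | inj₂ (there y′∈bs) = y′ , ∈-++⁺ʳ as y′∈bs , Rx′y′

d-⊆ : ∀ {κ μ ν} → κ ⊆ ν → d κ μ ν ≡ length (rectifying κ μ ν)
d-⊆ {κ} {μ} {ν} κ⊆ν = cong (λ b → if b then length (rectifying κ μ ν) else 0) (dec-true (κ ⊆? ν) κ⊆ν)

d-⊈ : ∀ {κ μ ν} → ¬ κ ⊆ ν → d κ μ ν ≡ 0
d-⊈ {κ} {μ} {ν} κ⊈ν = cong (λ b → if b then length (rectifying κ μ ν) else 0) (dec-false (κ ⊆? ν) κ⊈ν)

d-≤ : ∀ κ μ ν → d κ μ ν ≤ d μ κ ν
d-≤ κ μ ν = compare (κ ⊆? ν) (μ ⊆? ν)
  where
  -- If μ is not contained in ν, no tableau of shape ν/κ rectifies to S_μ.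
  empty : κ ⊆ ν → ¬ μ ⊆ ν → ∀ {Fs} → Fs ≡ rectifying κ μ ν → length Fs ≡ 0
  empty _   _   {[]}    _    = refl
  empty κ⊆ν μ⊈ν {F ∷ _} eq   = ⊥-elim (μ⊈ν (proj₁ (transpose {κ} {μ} {ν} κ⊆ν (subst (F ∈_) eq (here refl)))))

  compare : Dec (κ ⊆ ν) → Dec (μ ⊆ ν) → d κ μ ν ≤ d μ κ ν
  compare (no κ⊈ν)  _         = ℕ.≤-trans (ℕ.≤-reflexive (d-⊈ {κ} {μ} {ν} κ⊈ν)) z≤n
  compare (yes κ⊆ν) (yes μ⊆ν) = subst₂ _≤_ (sym (d-⊆ {κ} {μ} {ν} κ⊆ν)) (sym (d-⊆ {μ} {κ} {ν} μ⊆ν))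
    (length-≤ {R = Transposed {κ} {μ} {ν}} (rectifying-unique κ μ ν) (λ F∈ → proj₂ (transpose {κ} {μ} {ν} κ⊆ν F∈)) (transposed-injective {κ} {μ} {ν}))
  compare (yes κ⊆ν) (no μ⊈ν)  = ℕ.≤-trans
    (ℕ.≤-reflexive (trans (d-⊆ {κ} {μ} {ν} κ⊆ν) (empty κ⊆ν μ⊈ν refl))) z≤n

d-comm : ∀ κ μ ν → d κ μ ν ≡ d μ κ ν
d-comm κ μ ν = ℕ.≤-antisym (d-≤ κ μ ν) (d-≤ μ κ ν)

D-comm : ∀ κ μ ν → D κ μ ν ≡ D μ κ ν
D-comm κ μ ν with Δ κ μ ν | Δ μ κ ν | cong (ℤ._- + ∣ ν ∣) (ℤ.+-comm (+ ∣ κ ∣) (+ ∣ μ ∣))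
... | + k      | .(+ k)      | refl = cong₂ (λ l m → monomial ((2^ (l ℤ.- + k)) ℚ.* (+ m ℚ./ 1)) k)
  (cong (ℤ._- + ℓ ν) (ℤ.+-comm (+ ℓ κ) (+ ℓ μ))) (d-comm κ μ ν)
... | -[1+ _ ] | .(-[1+ _ ]) | refl = refl

------------------------------------------------------------------------
-- Arithmetic of ℚ[z]

coeff-⊕ : ∀ p q k → coeff (p ⊕ q) k ≡ coeff p k ℚ.+ coeff q k
coeff-⊕ []      q       k       = sym (ℚ.+-identityˡ (coeff q k))
coeff-⊕ (a ∷ p) []      k       = sym (ℚ.+-identityʳ (coeff (a ∷ p) k))
coeff-⊕ (a ∷ p) (b ∷ q) zero    = refl
coeff-⊕ (a ∷ p) (b ∷ q) (suc k) = coeff-⊕ p q k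

coeff-map : ∀ a p k → coeff (map (a ℚ.*_) p) k ≡ a ℚ.* coeff p k
coeff-map a []      k       = sym (ℚ.*-zeroʳ a)
coeff-map a (b ∷ p) zero    = refl
coeff-map a (b ∷ p) (suc k) = coeff-map a p k

∷-cong : ∀ a p q → p ≈ q → a ∷ p ≈ a ∷ q
∷-cong a p q p≈q zero    = refl
∷-cong a p q p≈q (suc k) = p≈q k

⊕-cong : ∀ p p′ q q′ → p ≈ p′ → q ≈ q′ → p ⊕ q ≈ p′ ⊕ q′
⊕-cong p p′ q q′ p≈ q≈ k =
  trans (coeff-⊕ p q k) (trans (cong₂ ℚ._+_ (p≈ k) (q≈ k)) (sym (coeff-⊕ p′ q′ k)))

⊕-congˡ : ∀ p q q′ → q ≈ q′ → p ⊕ q ≈ p ⊕ q′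
⊕-congˡ p q q′ = ⊕-cong p p q q′ (λ _ → refl)

⊗-[] : ∀ p → p ⊗ [] ≈ []
⊗-[] []      k       = refl
⊗-[] (a ∷ p) zero    = refl
⊗-[] (a ∷ p) (suc k) = ⊗-[] p k

⊗-∷ : ∀ p b q → p ⊗ (b ∷ q) ≈ map (b ℚ.*_) p ⊕ (0ℚ ∷ (p ⊗ q))
⊗-∷ []      b q zero    = refl
⊗-∷ []      b q (suc k) = refl
⊗-∷ (a ∷ p) b q zero    = cong (ℚ._+ 0ℚ) (ℚ.*-comm a b)
⊗-∷ (a ∷ p) b q (suc k) = begin
  coeff (aq ⊕ (p ⊗ (b ∷ q))) k                ≡⟨ ⊕-congˡ aq (p ⊗ (b ∷ q)) (bp ⊕ pq) (⊗-∷ p b q) k ⟩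
  coeff (aq ⊕ (bp ⊕ pq)) k                    ≡⟨ coeff-⊕ aq (bp ⊕ pq) k ⟩
  coeff aq k ℚ.+ coeff (bp ⊕ pq) k            ≡⟨ cong (coeff aq k ℚ.+_) (coeff-⊕ bp pq k) ⟩
  coeff aq k ℚ.+ (coeff bp k ℚ.+ coeff pq k)  ≡⟨ x∙yz≈y∙xz (coeff aq k) (coeff bp k) (coeff pq k) ⟩
  coeff bp k ℚ.+ (coeff aq k ℚ.+ coeff pq k)  ≡⟨ cong (coeff bp k ℚ.+_) (coeff-⊕ aq pq k) ⟨
  coeff bp k ℚ.+ coeff (aq ⊕ pq) k            ≡⟨ coeff-⊕ bp (aq ⊕ pq) k ⟨
  coeff (bp ⊕ (aq ⊕ pq)) k                    ∎
  where
  open ≡-Reasoning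
  aq = map (a ℚ.*_) q
  bp = map (b ℚ.*_) p
  pq = 0ℚ ∷ (p ⊗ q)

⊗-comm : ∀ p q → p ⊗ q ≈ q ⊗ p
⊗-comm []      q k = sym (⊗-[] q k)
⊗-comm (a ∷ p) q k = trans
  (⊕-congˡ (map (a ℚ.*_) q) (0ℚ ∷ (p ⊗ q)) (0ℚ ∷ (q ⊗ p)) (∷-cong 0ℚ (p ⊗ q) (q ⊗ p) (⊗-comm p q)) k)
  (sym (⊗-∷ q a p k))

⊗-congˡ : ∀ p q q′ → q ≈ q′ → p ⊗ q ≈ p ⊗ q′
⊗-congˡ []      q q′ q≈ k = refl
⊗-congˡ (a ∷ p) q q′ q≈ = ⊕-cong (map (a ℚ.*_) q) (map (a ℚ.*_) q′) (0ℚ ∷ (p ⊗ q)) (0ℚ ∷ (p ⊗ q′))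
  (λ k → trans (coeff-map a q k) (trans (cong (a ℚ.*_) (q≈ k)) (sym (coeff-map a q′ k))))
  (∷-cong 0ℚ (p ⊗ q) (p ⊗ q′) (⊗-congˡ p q q′ q≈))

⊗-congʳ : ∀ p p′ q → p ≈ p′ → p ⊗ q ≈ p′ ⊗ q
⊗-congʳ p p′ q p≈ k = trans (⊗-comm p q k) (trans (⊗-congˡ q p p′ p≈ k) (⊗-comm q p′ k))

module _ {A : Set} where

  ∑-cong : ∀ (xs : List A) (f g : A → ℚ[z]) → (∀ x → f x ≈ g x) → ∑ xs f ≈ ∑ xs g
  ∑-cong []       f g f≈g k = refl
  ∑-cong (x ∷ xs) f g f≈g = ⊕-cong (f x) (g x) (∑ xs f) (∑ xs g) (f≈g x) (∑-cong xs f g f≈g)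

  ∑-[] : ∀ (xs : List A) → ∑ xs (λ _ → []) ≈ []
  ∑-[] []       k = refl
  ∑-[] (x ∷ xs) k = ∑-[] xs k

  ∑-⊕ : ∀ (xs : List A) (f g : A → ℚ[z]) → ∑ xs (λ x → f x ⊕ g x) ≈ ∑ xs f ⊕ ∑ xs g
  ∑-⊕ []       f g k = refl
  ∑-⊕ (x ∷ xs) f g k = begin
    coeff ((f x ⊕ g x) ⊕ ∑ xs (λ x → f x ⊕ g x)) k
      ≡⟨ ⊕-congˡ (f x ⊕ g x) (∑ xs (λ x → f x ⊕ g x)) (∑ xs f ⊕ ∑ xs g) (∑-⊕ xs f g) k ⟩
    coeff ((f x ⊕ g x) ⊕ (∑ xs f ⊕ ∑ xs g)) k
      ≡⟨ trans (coeff-⊕ (f x ⊕ g x) (∑ xs f ⊕ ∑ xs g) k) (cong₂ ℚ._+_ (coeff-⊕ (f x) (g x) k) (coeff-⊕ (∑ xs f) (∑ xs g) k)) ⟩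
    (coeff (f x) k ℚ.+ coeff (g x) k) ℚ.+ (coeff (∑ xs f) k ℚ.+ coeff (∑ xs g) k)
      ≡⟨ interchange (coeff (f x) k) (coeff (g x) k) (coeff (∑ xs f) k) (coeff (∑ xs g) k) ⟩
    (coeff (f x) k ℚ.+ coeff (∑ xs f) k) ℚ.+ (coeff (g x) k ℚ.+ coeff (∑ xs g) k)
      ≡⟨ trans (coeff-⊕ (f x ⊕ ∑ xs f) (g x ⊕ ∑ xs g) k) (cong₂ ℚ._+_ (coeff-⊕ (f x) (∑ xs f) k) (coeff-⊕ (g x) (∑ xs g) k)) ⟨
    coeff ((f x ⊕ ∑ xs f) ⊕ (g x ⊕ ∑ xs g)) k ∎
    where open ≡-Reasoning

∑-comm : ∀ {A B : Set} (xs : List A) (ys : List B) (f : A → B → ℚ[z]) →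
  ∑ xs (λ x → ∑ ys (f x)) ≈ ∑ ys (λ y → ∑ xs (λ x → f x y))
∑-comm []       ys f k = sym (∑-[] ys k)
∑-comm (x ∷ xs) ys f k = trans
  (⊕-congˡ (∑ ys (f x)) (∑ xs (λ x → ∑ ys (f x))) (∑ ys (λ y → ∑ xs (λ x → f x y))) (∑-comm xs ys f) k)
  (sym (∑-⊕ ys (f x) (λ y → ∑ xs (λ x → f x y)) k))

⋆-comm : ∀ {n} → Commutative (_≈ᴿ_ {n}) _⋆_
⋆-comm {n} x y ν k = trans (∑-comm (basis n) (basis n) (λ κ μ → term x y κ μ) k)
  (∑-cong (basis n) (λ μ → ∑ (basis n) (λ κ → term x y κ μ)) (λ μ → ∑ (basis n) (term y x μ))
    (λ μ → ∑-cong (basis n) (λ κ → term x y κ μ) (term y x μ) (λ κ → term-comm κ μ)) k)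
  where
  term : R n → R n → Basis n → Basis n → ℚ[z]
  term x y κ μ = (x κ ⊗ y μ) ⊗ (κ [⋆] μ) ν

  term-comm : ∀ κ μ → term x y κ μ ≈ term y x μ κ
  term-comm κ μ k = trans
    (⊗-congʳ (x κ ⊗ y μ) (y μ ⊗ x κ) ((κ [⋆] μ) ν) (⊗-comm (x κ) (y μ)) k)
    (cong (λ D′ → coeff ((y μ ⊗ x κ) ⊗ D′) k) (D-comm (partition κ) (partition μ) (partition ν)))

theorem9p5 : (n : ℕ) → n ≥ 1 →
    ((κ μ ν : StrictPartition) → κ ⊆ ρ n → μ ⊆ ρ n → ν ⊆ ρ n → D κ μ ν ≈ D μ κ ν)
    × Commutative (_≈ᴿ_ {n}) _⋆_
theorem9p5 n _ = (λ κ μ ν _ _ _ k → cong (λ D′ → coeff D′ k) (D-comm κ μ ν)) , ⋆-comm
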